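{- Let $q$ be an odd prime power and let $\mathcal{S}$ be an $(n-1)$-spread of $\mathrm{PG}(3n-1,q)$ containing three (distinct) normal elements contained in the same $(2n-1)$-dimensional subspace $\Pi_0$. Then there exist a spread set $\mathbf{M}_0$ containing $0$ and $I$, a semifield spread set $\mathbf{M}$, and a collineation $\varphi$ of $\mathrm{PG}(3n-1,q)$ with $\varphi(\Pi_0)=\{(x,y,0)_{\mathbb{F}_q}\}$ and $\varphi(\mathcal{S})=\mathcal{T}_3(\mathbf{M},\mathbf{M}_0)$. Furthermore, $\varphi$ maps the set of normal elements of $\mathcal{S}$ contained in $\Pi_0$ onto $\{(I,C,0): C\in\mathbf{M}_0\cap\mathcal{N}_r(\mathbf{M})\}\cup\{(0,I,0)\}$.
   Context: An $(n-1)$-spread of $\mathrm{PG}(N-1,q)$ is a set of $(n-1)$-dimensional subspaces partitioning the point set. An element $E$ of an $(n-1)$-spread $\mathcal{S}$ of $\mathrm{PG}(3n-1,q)$ is normal if for every $F\in\mathcal{S}\setminus\{E\}$ the $(2n-1)$-space $\langle E,F\rangle$ is partitioned by elements of $\mathcal{S}$. Coordinates: points of $\mathrm{PG}(3n-1,q)$ are $(x_1,x_2,x_3)_{\mathbb{F}_q}$, $x_i\in\mathbb{F}_q^n$ row vectors, not all zero, up to $\mathbb{F}_q^*$-scalars; for $n\times n$ matrices with $[A_1\ A_2\ A_3]$ of rank $n$, $(A_1,A_2,A_3)=\{(xA_1,xA_2,xA_3)_{\mathbb{F}_q}:x\neq0\}$; $I,0$ are the identity and zero matrices. A spread set is a set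 $\mathbf{M}$ of $q^n$ $n\times n$ matrices over $\mathbb{F}_q$ with $A-B$ nonsingular for distinct $A,B\in\mathbf{M}$. A semifield spread set is a spread set containing $0$ and $I$ that is closed under addition. For spread sets $\mathbf{M},\mathbf{M}_0$ containing $0$ and $I$, $\mathcal{T}_3(\mathbf{M},\mathbf{M}_0)=\{(A,B,I):A,B\in\mathbf{M}\}\cup\{(I,C,0):C\in\mathbf{M}_0\}\cup\{(0,I,0)\}$. For a spread set $\mathbf{M}$, $\mathcal{N}_r(\mathbf{M})=\{X\in\mathbf{M}: X=0 \text{ or } \mathbf{M}X=\mathbf{M}\}$, where $\mathbf{M}X=\{AX:A\in\mathbf{M}\}$. -}

module Defs where

open import Level using (Level; _⊔_) renaming (suc to lsuc)
open import Data.Nat using (ℕ; zero; suc; _^_; _≤_)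
open import Data.Nat.Primality using (Prime)
open import Data.Fin using (Fin)
open import Data.Vec using (Vec; []; _∷_; replicate; zipWith; map; foldr; tabulate; lookup)
open import Data.List using (List; length)
open import Data.List.Membership.Propositional using (_∈_)
open import Data.List.Relation.Unary.Unique.Propositional using (Unique)
open import Data.Product using (Σ; ∃; _×_; _,_; proj₁; proj₂)
open import Data.Sum using (_⊎_)
open import Relation.Nullary using (¬_)
open import Relation.Binary.PropositionalEquality using (_≡_; _≢_)
open import Algebra.Structures using (IsCommutativeRing)

OddPrimePower : ℕ → Set
OddPrimePower q = Σ ℕ λ p → Σ ℕ λ h → Prime p × p ≢ 2 × 1 ≤ h × q ≡ p ^ h

record FiniteField (q : ℕ) : Set where
  infixl 6 _+_
  infixl 7 _*_
  field
    _+_ _*_ : Fin q → Fin q → Fin q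
    -_      : Fin q → Fin q
    0# 1#   : Fin q
    isCommutativeRing : IsCommutativeRing _≡_ _+_ _*_ -_ 0# 1#
    0≢1     : 0# ≢ 1#
    inverse : ∀ a → a ≢ 0# → Σ (Fin q) λ b → a * b ≡ 1#

module Geometry {q : ℕ} (𝔽 : FiniteField q) (n : ℕ) where
  open FiniteField 𝔽

  F : Set
  F = Fin q

  V : Set
  V = Vec F n

  0v : V
  0v = replicate n 0#

  _+v_ : V → V → V
  _+v_ = zipWith _+_

  _·v_ : F → V → V
  a ·v x = map (a *_) x

  -- n × n matrices, as lists of rows
  Mat : Set
  Mat = Vec V n

  _⊙_ : V → Mat → V
  x ⊙ A = foldr (λ _ → V) _+v_ 0v (zipWith _·v_ x A)

  0M : Mat
  0M = replicate n 0v

  IM : Mat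
  IM = tabulate λ i → tabulate λ j → δ i j
    where
    δ : Fin n → Fin n → F
    δ i j with Data.Fin._≟_ i j
    ... | Relation.Nullary.yes _ = 1#
    ... | Relation.Nullary.no _  = 0#

  _+M_ : Mat → Mat → Mat
  _+M_ = zipWith _+v_

  _-M_ : Mat → Mat → Mat
  A -M B = A +M map (map -_) B

  _·M_ : Mat → Mat → Mat
  A ·M X = map (_⊙ X) A

  Nonsingular : Mat → Set
  Nonsingular A = ∀ x → x ⊙ A ≡ 0v → x ≡ 0v

  IsSpreadSet : List Mat → Set
  IsSpreadSet 𝐌 = Unique 𝐌 × length 𝐌 ≡ q ^ n
    × (∀ A B → A ∈ 𝐌 → B ∈ 𝐌 → A ≢ B → Nonsingular (A -M B))

  IsSpreadSet₀I : List Mat → Set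
  IsSpreadSet₀I 𝐌 = IsSpreadSet 𝐌 × 0M ∈ 𝐌 × IM ∈ 𝐌

  IsSemifieldSpreadSet : List Mat → Set
  IsSemifieldSpreadSet 𝐌 = IsSpreadSet₀I 𝐌
    × (∀ A B → A ∈ 𝐌 → B ∈ 𝐌 → (A +M B) ∈ 𝐌)

  RightStable : List Mat → Mat → Set
  RightStable 𝐌 X = (∀ A → A ∈ 𝐌 → (A ·M X) ∈ 𝐌)
    × (∀ B → B ∈ 𝐌 → Σ Mat λ A → A ∈ 𝐌 × A ·M X ≡ B)

  InNr : List Mat → Mat → Set
  InNr 𝐌 X = X ∈ 𝐌 × (X ≡ 0M ⊎ RightStable 𝐌 X)

  W : Set
  W = V × V × V

  0W : W
  0W = 0v , 0v , 0v

  _+W_ : W → W → W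
  (a , b , c) +W (a' , b' , c') = (a +v a') , (b +v b') , (c +v c')

  _·W_ : F → W → W
  λ' ·W (a , b , c) = (λ' ·v a) , (λ' ·v b) , (λ' ·v c)

  lincomb : ∀ {d} → Vec F d → Vec W d → W
  lincomb c b = foldr (λ _ → W) _+W_ 0W (zipWith _·W_ c b)

  LinIndep : ∀ {d} → Vec W d → Set
  LinIndep {d} b = ∀ c → lincomb c b ≡ 0W → c ≡ replicate d 0#

  InSpan : ∀ {d} → Vec W d → W → Set
  InSpan b w = Σ _ λ c → lincomb c b ≡ w

  Pred : Set₁
  Pred = W → Set

  _⊆_ : Pred → Pred → Set
  U ⊆ U' = ∀ w → U w → U' w

  _≐_ : Pred → Pred → Set
  U ≐ U' = U ⊆ U' × U' ⊆ U

  -- U is a vector subspace of dimension d,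
  -- i.e. a projective (d-1)-dimensional subspace of PG(3n-1,q)
  IsSubspace : ℕ → Pred → Set
  IsSubspace d U = Σ (Vec W d) λ b → LinIndep b × (∀ w → (U w → InSpan b w) × (InSpan b w → U w))

  Join : Pred → Pred → Pred
  Join E E' w = Σ W λ u → Σ W λ v → E u × E' v × w ≡ u +W v

  -- points of PG(3n-1,q) are nonzero vectors up to nonzero scalars
  NonZeroW : W → Set
  NonZeroW w = w ≢ 0W

  _∼_ : W → W → Set
  w ∼ w' = Σ F λ a → a ≢ 0# × w' ≡ a ·W w

  Family : Set₁
  Family = Pred → Set

  IsSpread : Family → Set₁
  IsSpread 𝒮 = (∀ E → 𝒮 E → IsSubspace n E)
    × (∀ w → NonZeroW w → Σ Pred λ E → 𝒮 E × E w)
    × (∀ E E' w → 𝒮 E → 𝒮 E' → NonZeroW w → E w → E' w → E ≐ E')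

  IsNormal : Family → Pred → Set₁
  IsNormal 𝒮 E = 𝒮 E × (∀ E' → 𝒮 E' → ¬ (E ≐ E') →
    ∀ w → NonZeroW w → Join E E' w →
      Σ Pred λ G → 𝒮 G × G ⊆ Join E E' × G w)

  -- Collineations of PG(3n-1,q): bijections of the point set mapping
  -- collinear triples exactly to collinear triples, given through a
  -- representative map on vectors.

  Collinear : W → W → W → Set
  Collinear a b c = Σ (Vec F 3) λ k → k ≢ replicate 3 0# × lincomb k (a ∷ b ∷ c ∷ []) ≡ 0W

  record IsCollineation (f : W → W) : Set where
    field
      nonzero   : ∀ w → NonZeroW w → NonZeroW (f w)
      wellDef   : ∀ w w' → NonZeroW w → w ∼ w' → f w ∼ f w'
      injective : ∀ w w' → NonZeroW w → NonZeroW w' → f w ∼ f w' → w ∼ w'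
      surjective : ∀ t → NonZeroW t → Σ W λ w → NonZeroW w × f w ∼ t
      collinear : ∀ a b c → NonZeroW a → NonZeroW b → NonZeroW c →
        (Collinear a b c → Collinear (f a) (f b) (f c)) ×
        (Collinear (f a) (f b) (f c) → Collinear a b c)

  ImageEq : (W → W) → Pred → Pred → Set
  ImageEq f E T = (∀ w → NonZeroW w → E w → T (f w))
    × (∀ t → NonZeroW t → T t → Σ W λ w → NonZeroW w × E w × f w ∼ t)

  MapsOnto : ∀ {a b : Level} → (W → W) → (Pred → Set a) → (Pred → Set b) → Set (lsuc Level.zero ⊔ a ⊔ b)
  MapsOnto f 𝒜 ℬ = (∀ E → 𝒜 E → Σ Pred λ T → ℬ T × ImageEq f E T)
    × (∀ T → ℬ T → Σ Pred λ E → 𝒜 E × ImageEq f E T)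

  -- (A₁,A₂,A₃) = { (xA₁,xA₂,xA₃) } (together with the zero vector)
  RowSp : Mat → Mat → Mat → Pred
  RowSp A₁ A₂ A₃ w = Σ V λ x → w ≡ ((x ⊙ A₁) , (x ⊙ A₂) , (x ⊙ A₃))

  Π∞ : Pred
  Π∞ (x , y , z) = z ≡ 0v

  T₃ : List Mat → List Mat → Family
  T₃ 𝐌 𝐌₀ P =
      (Σ Mat λ A → Σ Mat λ B → A ∈ 𝐌 × B ∈ 𝐌 × P ≐ RowSp A B IM)
    ⊎ (Σ Mat λ C → C ∈ 𝐌₀ × P ≐ RowSp IM C 0M)
    ⊎ (P ≐ RowSp 0M IM 0M)

  NormalTarget : List Mat → List Mat → Family
  NormalTarget 𝐌 𝐌₀ P =
      (Σ Mat λ C → C ∈ 𝐌₀ × InNr 𝐌 C × P ≐ RowSp IM C 0M)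
    ⊎ (P ≐ RowSp 0M IM 0M)

  NormalIn : Family → Pred → Pred → Set₁
  NormalIn 𝒮 Π₀ E = IsNormal 𝒮 E × E ⊆ Π₀

{-# OPTIONS --safe #-}
-- Let E₁ = (0,I,0), E₂ = (I,0,0) and let (0,0,I) be an element outside Π₀.  Normality of E₁ and E₂
-- says that the elements outside Π₀ are exactly the (A,B,I) with A ∈ M₁ and B ∈ M₂, for two sets of
-- matrices with 0 ∈ M₁, M₂.  Scaling coordinates so that E₃ = (I,I,0) and I ∈ M₁, normality of E₃
-- gives B − A ∈ M₂ and A − B ∈ M₁ for all such A, B, and hence M₁ = M₂ is closed under addition.
-- In the same way an element (I,C,0) is normal iff B − AC ∈ M for all A, B ∈ M, i.e. iff MC ⊆ M.
-- All dimension arguments are replaced by counting: an injective map between finite sets of the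
-- same size is surjective.
module Submission where

open import Defs
open import Level using (0ℓ)
open import Data.Nat using (ℕ; zero; suc; _^_)
import Data.Nat as ℕ
import Data.Nat.Properties as ℕ
open import Data.Fin as Fin using (Fin; zero; suc)
import Data.Fin.Properties as Fin
open import Data.List as List using (List; length; allFin)
import Data.List.Properties as List
open import Data.List.Membership.Propositional using (_∈_)
import Data.List.Membership.Propositional.Properties as List
open import Data.List.Relation.Unary.Unique.Propositional using (Unique)
import Data.List.Relation.Unary.Unique.Propositional.Properties as Unique
open import Data.Vec as Vec using (Vec; []; _∷_; replicate; zipWith; map; foldr; tabulate; lookup)
import Data.Vec.Properties as Vec
open import Data.Product using (Σ; ∃; _×_; _,_; proj₁; proj₂)
open import Data.Product.Function.NonDependent.Propositional using (_×-↔_)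
open import Data.Sum using (_⊎_; inj₁; inj₂; [_,_]′)
open import Data.Empty using (⊥-elim)
open import Function using (_∘_; _↔_; case_of_; mk↔ₛ′; Inverse)
open import Function.Construct.Composition using (_↔-∘_)
open import Function.Construct.Symmetry using (↔-sym)
open import Relation.Nullary using (¬_; Dec; yes; no; contradiction; decidable-stable)
open import Relation.Nullary.Decidable using (map′; ¬?)
open import Relation.Binary.Definitions using (DecidableEquality)
open import Relation.Binary.PropositionalEquality
  using (_≡_; _≢_; refl; sym; trans; cong; cong₂; subst; isEquivalence; module ≡-Reasoning)
open import Algebra.Bundles using (AbelianGroup)
open import Algebra.Structures using (IsAbelianGroup; IsCommutativeRing)
import Algebra.Properties.AbelianGroup as AbelianGroupProperties
import Algebra.Properties.CommutativeSemigroup as CommutativeSemigroupProperties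

-- A spread element is determined by any one of its points, so a matrix of M is determined by its
-- value at any one nonzero vector, and every value occurs. This yields the q^n matrices and the
-- nonsingular differences, and it lets matrices be compared at a single fixed vector `e`. Normality
-- is exploited in one form throughout: a chosen point of the join of (P,Q,0) and (A,B,I) with third
-- coordinate `e` lies on an element (A',B',I) inside that join, so xA' = tP + xA and xB' = tQ + xB
-- with a common t depending on x. If the point is chosen so that A' (or B') vanishes at `e`, that
-- matrix is zero, one equation constrains t for every x, and the other matrix can be read off. With
-- E₃ this produces differences only, so sums are obtained as double differences, negatives come
-- after sums, and M₁ = M₂ rests on 0 - (-A) = A. The spread consists of bare predicates with no
-- decidability assumed; case distinctions are therefore made on vectors, which form a finite set.

-- Finite sets and counting.

module _ {A : Set} {N : ℕ} (A↔ : A ↔ Fin N) where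
  open Inverse A↔

  to-injective : ∀ {x y} → to x ≡ to y → x ≡ y
  to-injective {x} {y} eq = trans (sym (strictlyInverseʳ x)) (trans (cong from eq) (strictlyInverseʳ y))

  from-injective : ∀ {i j} → from i ≡ from j → i ≡ j
  from-injective {i} {j} eq = trans (sym (strictlyInverseˡ i)) (trans (cong to eq) (strictlyInverseˡ j))

  abstract
    finite-≟ : DecidableEquality A
    finite-≟ x y = map′ to-injective (cong to) (to x Fin.≟ to y)

  finite-any? : ∀ {P : A → Set} → (∀ x → Dec (P x)) → Dec (∃ P)
  finite-any? {P} P? = map′ (λ (i , p) → from i , p)
    (λ (x , p) → to x , subst P (sym (strictlyInverseʳ x)) p) (Fin.any? (P? ∘ from))

-- A missed value `j` could be punched out of the codomain, leaving an injection of `Fin (suc N)`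
-- into `Fin N`.
endo-surjective : ∀ {N} (f : Fin N → Fin N) → (∀ {i j} → f i ≡ f j → i ≡ j) →
  ∀ j → Σ (Fin N) λ i → f i ≡ j
endo-surjective {suc N} f inj j with Fin.any? (λ i → f i Fin.≟ j)
... | yes p = p
... | no ¬p = contradiction (Fin.injective⇒≤ {f = λ i → Fin.punchOut (j≢f i)} (λ {i} {i'} eq →
    inj (Fin.punchOut-injective (j≢f i) (j≢f i') eq))) ℕ.1+n≰n
  where
  j≢f : ∀ i → j ≢ f i
  j≢f i eq = ¬p (i , sym eq)

injective⇒surjective : ∀ {A B : Set} {N} → A ↔ Fin N → B ↔ Fin N → (f : A → B) →
  (∀ {x y} → f x ≡ f y → x ≡ y) → ∀ b → Σ A λ a → f a ≡ b
injective⇒surjective A↔ B↔ f inj b =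
  let i , eq = endo-surjective (B.to ∘ f ∘ A.from)
                 (λ e → from-injective A↔ (inj (to-injective B↔ e))) (B.to b)
  in A.from i , to-injective B↔ eq
  where
  module A = Inverse A↔
  module B = Inverse B↔

Vec↔Fin : ∀ {q} d → Vec (Fin q) d ↔ Fin (q ^ d)
Vec↔Fin {q} d = mk↔ₛ′ (λ v → Fin.funToFin (lookup v)) (λ i → tabulate (Fin.finToFun {q} {d} i))
  (λ i → trans (funToFin-cong (Vec.lookup∘tabulate (Fin.finToFun {q} {d} i))) (Fin.funToFin-finToFin {d} {q} i))
  (λ v → trans (Vec.tabulate-cong (Fin.finToFun-funToFin (lookup v))) (Vec.tabulate∘lookup v))
  where
  funToFin-cong : ∀ {m n} {f g : Fin m → Fin n} → (∀ i → f i ≡ g i) → Fin.funToFin f ≡ Fin.funToFin g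
  funToFin-cong {zero} eq = refl
  funToFin-cong {suc m} eq = cong₂ Fin.combine (eq zero) (funToFin-cong (eq ∘ suc))

×↔Fin : ∀ {A B : Set} {M N} → A ↔ Fin M → B ↔ Fin N → (A × B) ↔ Fin (M ℕ.* N)
×↔Fin A↔ B↔ = ↔-sym Fin.*↔× ↔-∘ (A↔ ×-↔ B↔)

distinct⇒1<size : ∀ {A : Set} {N} → A ↔ Fin N → ∀ {x y : A} → x ≢ y → 1 ℕ.< N
distinct⇒1<size {N = zero} A↔ {x} _ = ⊥-elim (case Inverse.to A↔ x of λ ())
distinct⇒1<size {N = suc zero} A↔ {x} {y} x≢y =
  contradiction (to-injective A↔ (trans (only (Inverse.to A↔ x)) (sym (only (Inverse.to A↔ y))))) x≢y
  where
  only : (i : Fin 1) → i ≡ zero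
  only zero = refl
distinct⇒1<size {N = suc (suc N)} _ _ = ℕ.s≤s (ℕ.s≤s ℕ.z≤n)

-- Meant for N = q^n: a subspace of dimension 2n has N² vectors and the whole space N³, so some
-- vector lies outside.
1<N⇒N²<N³ : ∀ {N} → 1 ℕ.< N → N ℕ.* N ℕ.< N ℕ.* (N ℕ.* N)
1<N⇒N²<N³ {N@(suc _)} 1<N = ℕ.*-monoʳ-< N (subst (ℕ._< N ℕ.* N) (ℕ.*-identityʳ N) (ℕ.*-monoʳ-< N 1<N))

-- Linear maps and subspaces over a finite field.

module LinearAlgebra {q : ℕ} (𝔽 : FiniteField q) where
  open FiniteField 𝔽
  open IsCommutativeRing isCommutativeRing
    using (distribˡ; distribʳ; *-assoc; *-identityˡ; +-isAbelianGroup)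

  record VectorSpace : Set₁ where
    infixl 6 _⊕_
    infixr 7 _·_
    field
      Carrier : Set
      _⊕_ : Carrier → Carrier → Carrier
      _·_ : Fin q → Carrier → Carrier
      ⊖_  : Carrier → Carrier
      𝟘   : Carrier
      isAbelianGroup : IsAbelianGroup _≡_ _⊕_ 𝟘 ⊖_
      ·-distribˡ : ∀ a x y → a · (x ⊕ y) ≡ a · x ⊕ a · y
      ·-distribʳ : ∀ x a b → (a + b) · x ≡ a · x ⊕ b · x
      ·-assoc    : ∀ a b x → (a * b) · x ≡ a · (b · x)
      ·-identity : ∀ x → 1# · x ≡ x

    abelianGroup : AbelianGroup 0ℓ 0ℓ
    abelianGroup = record { isAbelianGroup = isAbelianGroup }

    open IsAbelianGroup isAbelianGroup public
      using (assoc; comm; identityˡ; identityʳ; inverseˡ; inverseʳ)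
    open AbelianGroupProperties abelianGroup public
      using (∙-cancelʳ; identityˡ-unique; inverseˡ-unique; x∙y⁻¹≈ε⇒x≈y; ⁻¹-∙-comm)
    open CommutativeSemigroupProperties (AbelianGroup.commutativeSemigroup abelianGroup) public
      using (interchange)

    ·-zeroʳ : ∀ a → a · 𝟘 ≡ 𝟘
    ·-zeroʳ a = identityˡ-unique (a · 𝟘) (a · 𝟘)
      (trans (sym (·-distribˡ a 𝟘 𝟘)) (cong (a ·_) (identityˡ 𝟘)))

    ·-zeroˡ : ∀ x → 0# · x ≡ 𝟘
    ·-zeroˡ x = identityˡ-unique (0# · x) (0# · x)
      (trans (sym (·-distribʳ x 0# 0#)) (cong (_· x) (IsAbelianGroup.identityˡ +-isAbelianGroup 0#)))

    -1· : ∀ x → (- 1#) · x ≡ ⊖ x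
    -1· x = inverseˡ-unique _ _ (begin
      (- 1#) · x ⊕ x        ≡⟨ cong ((- 1#) · x ⊕_) (·-identity x) ⟨
      (- 1#) · x ⊕ 1# · x   ≡⟨ ·-distribʳ x (- 1#) 1# ⟨
      (- 1# + 1#) · x       ≡⟨ cong (_· x) (IsAbelianGroup.inverseˡ +-isAbelianGroup 1#) ⟩
      0# · x                ≡⟨ ·-zeroˡ x ⟩
      𝟘                     ∎)
      where open ≡-Reasoning

  open VectorSpace using () renaming (Carrier to ∣_∣)

  infix 4 _⊸_
  record _⊸_ (X Y : VectorSpace) : Set where
    private
      module X = VectorSpace X
      module Y = VectorSpace Y
    infixr 5 _⟨$⟩_
    field
      _⟨$⟩_  : X.Carrier → Y.Carrier
      ⊕-homo : ∀ x y → _⟨$⟩_ (x X.⊕ y) ≡ _⟨$⟩_ x Y.⊕ _⟨$⟩_ y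
      ·-homo : ∀ a x → _⟨$⟩_ (a X.· x) ≡ a Y.· _⟨$⟩_ x

    𝟘-homo : _⟨$⟩_ X.𝟘 ≡ Y.𝟘
    𝟘-homo = trans (cong _⟨$⟩_ (sym (X.·-zeroˡ X.𝟘))) (trans (·-homo 0# X.𝟘) (Y.·-zeroˡ _))

    ⊖-homo : ∀ x → _⟨$⟩_ (X.⊖ x) ≡ Y.⊖ _⟨$⟩_ x
    ⊖-homo x = trans (cong _⟨$⟩_ (sym (X.-1· x))) (trans (·-homo (- 1#) x) (Y.-1· _))

    TrivialKernel : Set
    TrivialKernel = ∀ x → _⟨$⟩_ x ≡ Y.𝟘 → x ≡ X.𝟘

    kernel⇒injective : TrivialKernel → ∀ {x y} → _⟨$⟩_ x ≡ _⟨$⟩_ y → x ≡ y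
    kernel⇒injective ker {x} {y} eq = X.x∙y⁻¹≈ε⇒x≈y x y (ker _ (begin
      _⟨$⟩_ (x X.⊕ X.⊖ y)            ≡⟨ ⊕-homo x (X.⊖ y) ⟩
      _⟨$⟩_ x Y.⊕ _⟨$⟩_ (X.⊖ y)      ≡⟨ cong₂ Y._⊕_ eq (⊖-homo y) ⟩
      _⟨$⟩_ y Y.⊕ Y.⊖ _⟨$⟩_ y        ≡⟨ Y.inverseʳ _ ⟩
      Y.𝟘                            ∎))
      where open ≡-Reasoning

  open _⊸_ public

  idₗ : ∀ {X} → X ⊸ X
  idₗ = record { _⟨$⟩_ = λ x → x ; ⊕-homo = λ _ _ → refl ; ·-homo = λ _ _ → refl }

  infixr 9 _∘ₗ_
  _∘ₗ_ : ∀ {X Y Z} → Y ⊸ Z → X ⊸ Y → X ⊸ Z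
  g ∘ₗ f = record
    { _⟨$⟩_  = λ x → g ⟨$⟩ f ⟨$⟩ x
    ; ⊕-homo = λ x y → trans (cong (g ⟨$⟩_) (⊕-homo f x y)) (⊕-homo g _ _)
    ; ·-homo = λ a x → trans (cong (g ⟨$⟩_) (·-homo f a x)) (·-homo g a _)
    }

  infixr 4 _⊗_
  _⊗_ : VectorSpace → VectorSpace → VectorSpace
  X ⊗ Y = record
    { Carrier = X.Carrier × Y.Carrier
    ; _⊕_ = λ (x , y) (x' , y') → x X.⊕ x' , y Y.⊕ y'
    ; _·_ = λ a (x , y) → a X.· x , a Y.· y
    ; ⊖_  = λ (x , y) → X.⊖ x , Y.⊖ y
    ; 𝟘   = X.𝟘 , Y.𝟘
    ; isAbelianGroup = record
      { isGroup = record
        { isMonoid = record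
          { isSemigroup = record
            { isMagma = record { isEquivalence = isEquivalence ; ∙-cong = λ { refl refl → refl } }
            ; assoc = λ x y z → cong₂ _,_ (X.assoc _ _ _) (Y.assoc _ _ _)
            }
          ; identity = (λ x → cong₂ _,_ (X.identityˡ _) (Y.identityˡ _))
                     , (λ x → cong₂ _,_ (X.identityʳ _) (Y.identityʳ _))
          }
        ; inverse = (λ x → cong₂ _,_ (X.inverseˡ _) (Y.inverseˡ _))
                  , (λ x → cong₂ _,_ (X.inverseʳ _) (Y.inverseʳ _))
        ; ⁻¹-cong = λ { refl → refl }
        }
      ; comm = λ x y → cong₂ _,_ (X.comm _ _) (Y.comm _ _)
      }
    ; ·-distribˡ = λ a x y → cong₂ _,_ (X.·-distribˡ _ _ _) (Y.·-distribˡ _ _ _)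
    ; ·-distribʳ = λ a x y → cong₂ _,_ (X.·-distribʳ _ _ _) (Y.·-distribʳ _ _ _)
    ; ·-assoc    = λ a b x → cong₂ _,_ (X.·-assoc _ _ _) (Y.·-assoc _ _ _)
    ; ·-identity = λ x → cong₂ _,_ (X.·-identity _) (Y.·-identity _)
    }
    where
    module X = VectorSpace X
    module Y = VectorSpace Y

  fst : ∀ {X Y} → (X ⊗ Y) ⊸ X
  fst = record { _⟨$⟩_ = proj₁ ; ⊕-homo = λ _ _ → refl ; ·-homo = λ _ _ → refl }

  snd : ∀ {X Y} → (X ⊗ Y) ⊸ Y
  snd = record { _⟨$⟩_ = proj₂ ; ⊕-homo = λ _ _ → refl ; ·-homo = λ _ _ → refl }

  ⟨_,_⟩ : ∀ {X Y Z} → X ⊸ Y → X ⊸ Z → X ⊸ (Y ⊗ Z)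
  ⟨ f , g ⟩ = record
    { _⟨$⟩_  = λ x → (f ⟨$⟩ x) , (g ⟨$⟩ x)
    ; ⊕-homo = λ x y → cong₂ _,_ (⊕-homo f x y) (⊕-homo g x y)
    ; ·-homo = λ a x → cong₂ _,_ (·-homo f a x) (·-homo g a x)
    }

  [_,_] : ∀ {X Y Z} → X ⊸ Z → Y ⊸ Z → (X ⊗ Y) ⊸ Z
  [_,_] {Z = Z} f g = record
    { _⟨$⟩_  = λ (x , y) → (f ⟨$⟩ x) ⊕ (g ⟨$⟩ y)
    ; ⊕-homo = λ (x , y) (x' , y') →
        trans (cong₂ _⊕_ (⊕-homo f x x') (⊕-homo g y y')) (interchange _ _ _ _)
    ; ·-homo = λ a (x , y) →
        trans (cong₂ _⊕_ (·-homo f a x) (·-homo g a y)) (sym (·-distribˡ a _ _))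
    }
    where open VectorSpace Z

  0ₗ : ∀ {X Y} → X ⊸ Y
  0ₗ {Y = Y} = record
    { _⟨$⟩_ = λ _ → 𝟘 ; ⊕-homo = λ _ _ → sym (identityˡ 𝟘) ; ·-homo = λ a _ → sym (·-zeroʳ a) }
    where open VectorSpace Y

  neg : ∀ {X} → X ⊸ X
  neg {X} = record
    { _⟨$⟩_ = ⊖_
    ; ⊕-homo = λ x y → sym (⁻¹-∙-comm x y)
    ; ·-homo = λ a x → ⊖-· a x
    }
    where
    open VectorSpace X
    ⊖-· : ∀ a x → ⊖ (a · x) ≡ a · (⊖ x)
    ⊖-· a x = sym (inverseˡ-unique _ _
      (trans (sym (·-distribˡ a _ _)) (trans (cong (a ·_) (inverseˡ x)) (·-zeroʳ a))))

  𝔽-space : VectorSpace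
  𝔽-space = record
    { isAbelianGroup = +-isAbelianGroup
    ; _·_ = _*_
    ; ·-distribˡ = distribˡ
    ; ·-distribʳ = distribʳ
    ; ·-assoc = *-assoc
    ; ·-identity = *-identityˡ
    }

  𝔽^ : ℕ → VectorSpace
  𝔽^ d = record
    { Carrier = Vec (Fin q) d
    ; _⊕_ = zipWith _+_
    ; _·_ = λ a → map (a *_)
    ; ⊖_  = map -_
    ; 𝟘   = replicate d 0#
    ; isAbelianGroup = record
      { isGroup = record
        { isMonoid = record
          { isSemigroup = record
            { isMagma = record { isEquivalence = isEquivalence ; ∙-cong = λ { refl refl → refl } }
            ; assoc = Vec.zipWith-assoc F.assoc
            }
          ; identity = Vec.zipWith-identityˡ F.identityˡ , Vec.zipWith-identityʳ F.identityʳ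
          }
        ; inverse = Vec.zipWith-inverseˡ F.inverseˡ , Vec.zipWith-inverseʳ F.inverseʳ
        ; ⁻¹-cong = λ { refl → refl }
        }
      ; comm = Vec.zipWith-comm F.comm
      }
    ; ·-distribˡ = map-distribˡ
    ; ·-distribʳ = map-distribʳ
    ; ·-assoc    = λ a b x → trans (Vec.map-cong (F.·-assoc a b) x) (Vec.map-∘ _ _ x)
    ; ·-identity = λ x → trans (Vec.map-cong F.·-identity x) (Vec.map-id x)
    }
    where
    module F = VectorSpace 𝔽-space
    map-distribˡ : ∀ {d} a (x y : Vec (Fin q) d) →
      map (a *_) (zipWith _+_ x y) ≡ zipWith _+_ (map (a *_) x) (map (a *_) y)
    map-distribˡ a [] [] = refl
    map-distribˡ a (x ∷ xs) (y ∷ ys) = cong₂ _∷_ (F.·-distribˡ a x y) (map-distribˡ a xs ys)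
    map-distribʳ : ∀ {d} (x : Vec (Fin q) d) a b →
      map ((a + b) *_) x ≡ zipWith _+_ (map (a *_) x) (map (b *_) x)
    map-distribʳ [] a b = refl
    map-distribʳ (x ∷ xs) a b = cong₂ _∷_ (F.·-distribʳ x a b) (map-distribʳ xs a b)

  coordinate : ∀ {d} → Fin d → 𝔽^ d ⊸ 𝔽-space
  coordinate i = record
    { _⟨$⟩_ = λ v → lookup v i
    ; ⊕-homo = Vec.lookup-zipWith _+_ i
    ; ·-homo = λ a x → Vec.lookup-map i (a *_) x
    }

  module _ (X : VectorSpace) where
    open VectorSpace X

    combination : ∀ {d} → Vec (Fin q) d → Vec Carrier d → Carrier
    combination c b = foldr (λ _ → Carrier) _⊕_ 𝟘 (zipWith _·_ c b)

    combination-⊕ : ∀ {d} (b : Vec Carrier d) c c' →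
      combination (zipWith _+_ c c') b ≡ combination c b ⊕ combination c' b
    combination-⊕ [] [] [] = sym (identityˡ 𝟘)
    combination-⊕ (b ∷ bs) (c ∷ cs) (c' ∷ cs') =
      trans (cong₂ _⊕_ (·-distribʳ b c c') (combination-⊕ bs cs cs')) (interchange _ _ _ _)

    combination-· : ∀ {d} (b : Vec Carrier d) a c →
      combination (map (a *_) c) b ≡ a · combination c b
    combination-· [] a [] = sym (·-zeroʳ a)
    combination-· (b ∷ bs) a (c ∷ cs) =
      trans (cong₂ _⊕_ (·-assoc a c b) (combination-· bs a cs)) (sym (·-distribˡ a _ _))

    combinationₗ : ∀ {d} → Vec Carrier d → 𝔽^ d ⊸ X
    combinationₗ b = record
      { _⟨$⟩_ = λ c → combination c b ; ⊕-homo = combination-⊕ b ; ·-homo = combination-· b }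

    combination-zipWith-⊕ : ∀ {d} c (b b' : Vec Carrier d) →
      combination c (zipWith _⊕_ b b') ≡ combination c b ⊕ combination c b'
    combination-zipWith-⊕ [] [] [] = sym (identityˡ 𝟘)
    combination-zipWith-⊕ (c ∷ cs) (b ∷ bs) (b' ∷ bs') =
      trans (cong₂ _⊕_ (·-distribˡ c b b') (combination-zipWith-⊕ cs bs bs')) (interchange _ _ _ _)

    combination-zero : ∀ {d} (b : Vec Carrier d) c → (∀ i → lookup c i ≡ 0#) → combination c b ≡ 𝟘
    combination-zero [] [] _ = refl
    combination-zero (b ∷ bs) (c ∷ cs) c≡0 =
      trans (cong₂ _⊕_ (trans (cong (_· b) (c≡0 zero)) (·-zeroˡ b)) (combination-zero bs cs (c≡0 ∘ suc)))
            (identityˡ 𝟘)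

    -- The unit vector is described by its entries, so that the lemma applies both to the rows and
    -- to the columns of `IM`.
    combination-unit : ∀ {d} (b : Vec Carrier d) c i → lookup c i ≡ 1# →
      (∀ j → i ≢ j → lookup c j ≡ 0#) → combination c b ≡ lookup b i
    combination-unit (b ∷ bs) (c ∷ cs) zero c≡1 c≡0 =
      trans (cong₂ _⊕_ (trans (cong (_· b) c≡1) (·-identity b))
                       (combination-zero bs cs λ j → c≡0 (suc j) λ ()))
            (identityʳ b)
    combination-unit (b ∷ bs) (c ∷ cs) (suc i) c≡1 c≡0 =
      trans (cong₂ _⊕_ (trans (cong (_· b) (c≡0 zero λ ())) (·-zeroˡ b))
                       (combination-unit bs cs i c≡1 λ j i≢j → c≡0 (suc j) (i≢j ∘ Fin.suc-injective)))
            (identityˡ _)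

  combination-homo : ∀ {X Y} (f : X ⊸ Y) {d} c (b : Vec ∣ X ∣ d) →
    f ⟨$⟩ combination X c b ≡ combination Y c (map (f ⟨$⟩_) b)
  combination-homo f [] [] = 𝟘-homo f
  combination-homo {X} {Y} f (c ∷ cs) (b ∷ bs) =
    trans (⊕-homo f _ _) (cong₂ (VectorSpace._⊕_ Y) (·-homo f c b) (combination-homo f cs bs))

  abstract
    -- Preimages under `k` may be picked point by point: injectivity of `k` makes the choice unique,
    -- and uniqueness makes it linear.
    lift : ∀ {X Y Z} (k : X ⊸ Y) → TrivialKernel k → (f : Z ⊸ Y) →
      (∀ z → Σ ∣ X ∣ λ x → (k ⟨$⟩ x) ≡ (f ⟨$⟩ z)) →
      Σ (Z ⊸ X) λ h → ∀ z → (k ⟨$⟩ h ⟨$⟩ z) ≡ (f ⟨$⟩ z)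
    lift {X} {Y} {Z} k ker f s = record
      { _⟨$⟩_  = h
      ; ⊕-homo = λ x y → kernel⇒injective k ker (trans (kh _) (trans (⊕-homo f x y)
          (sym (trans (⊕-homo k _ _) (cong₂ (VectorSpace._⊕_ Y) (kh x) (kh y))))))
      ; ·-homo = λ a x → kernel⇒injective k ker (trans (kh _) (trans (·-homo f a x)
          (sym (trans (·-homo k a _) (cong (VectorSpace._·_ Y a) (kh x))))))
      } , kh
      where
      h : ∣ Z ∣ → ∣ X ∣
      h z = proj₁ (s z)
      kh : ∀ z → (k ⟨$⟩ h z) ≡ (f ⟨$⟩ z)
      kh z = proj₂ (s z)

    right-inverse : ∀ {X Y N} → ∣ X ∣ ↔ Fin N → ∣ Y ∣ ↔ Fin N → (f : X ⊸ Y) → TrivialKernel f →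
      Σ (Y ⊸ X) λ g → ∀ y → (f ⟨$⟩ g ⟨$⟩ y) ≡ y
    right-inverse X↔ Y↔ f ker =
      lift f ker idₗ (injective⇒surjective X↔ Y↔ (f ⟨$⟩_) (kernel⇒injective f ker))

  -- Stands in for a basis: the subspace `U` is an injective linear image of `X`, so the size of `X`
  -- plays the part of the dimension.
  record Parametrization (X Y : VectorSpace) (U : ∣ Y ∣ → Set) : Set where
    field
      map-to   : X ⊸ Y
      kernel   : TrivialKernel map-to
      sound    : ∀ x → U (map-to ⟨$⟩ x)
      complete : ∀ y → U y → Σ ∣ X ∣ λ x → (map-to ⟨$⟩ x) ≡ y

  module _ {X Y : VectorSpace} {U : ∣ Y ∣ → Set} (P : Parametrization X Y U) where
    open VectorSpace Y
    open Parametrization P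

    abstract
      closed-⊕ : ∀ {y y'} → U y → U y' → U (y ⊕ y')
      closed-⊕ Uy Uy' with complete _ Uy | complete _ Uy'
      ... | x , refl | x' , refl = subst U (⊕-homo map-to x x') (sound _)

      closed-⊖ : ∀ {y} → U y → U (⊖ y)
      closed-⊖ Uy with complete _ Uy
      ... | x , refl = subst U (⊖-homo map-to x) (sound _)

      closed-𝟘 : U 𝟘
      closed-𝟘 = subst U (𝟘-homo map-to) (sound _)

      closed-cancelˡ : ∀ {y y'} → U y → U (y ⊕ y') → U y'
      closed-cancelˡ {y} {y'} Uy Usum = subst U
        (trans (sym (assoc (⊖ y) y y')) (trans (cong (_⊕ y') (inverseˡ y)) (identityˡ y')))
        (closed-⊕ (closed-⊖ Uy) Usum)

      closed-cancelʳ : ∀ {y y'} → U y' → U (y ⊕ y') → U y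
      closed-cancelʳ {y} {y'} Uy' Usum = closed-cancelˡ Uy' (subst U (comm y y') Usum)

    pullback : ∀ {Z} (φ : Y ⊸ Z) (Φ : Z ⊸ Y) →
      (∀ z → (φ ⟨$⟩ Φ ⟨$⟩ z) ≡ z) → (∀ y → (Φ ⟨$⟩ φ ⟨$⟩ y) ≡ y) →
      Parametrization X Z (λ z → U (Φ ⟨$⟩ z))
    pullback φ Φ φΦ Φφ = record
      { map-to   = φ ∘ₗ map-to
      ; kernel   = λ x eq → kernel x (trans (sym (Φφ _)) (trans (cong (Φ ⟨$⟩_) eq) (𝟘-homo Φ)))
      ; sound    = λ x → subst U (sym (Φφ _)) (sound x)
      ; complete = λ z UΦz → let x , eq = complete _ UΦz in x , trans (cong (φ ⟨$⟩_) eq) (φΦ z)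
      }

    abstract
      -- The counting form of "a subspace of full dimension is everything": `k` factors through
      -- `map-to` by an injective map between sets of equal size, which is onto.
      fill : ∀ {Z N} → ∣ X ∣ ↔ Fin N → ∣ Z ∣ ↔ Fin N → (k : Z ⊸ Y) → TrivialKernel k →
        (∀ z → U (k ⟨$⟩ z)) → ∀ y → U y → Σ ∣ Z ∣ λ z → (k ⟨$⟩ z) ≡ y
      fill X↔ Z↔ k ker k∈U y Uy =
        let h , mh≡k = lift map-to kernel k (λ z → complete _ (k∈U z))
            x , mx≡y = complete y Uy
            z , hz≡x = injective⇒surjective Z↔ X↔ (h ⟨$⟩_) (λ {z} {z'} eq →
              kernel⇒injective k ker (trans (sym (mh≡k z)) (trans (cong (map-to ⟨$⟩_) eq) (mh≡k z')))) x
        in z , trans (sym (mh≡k z)) (trans (cong (map-to ⟨$⟩_) hz≡x) mx≡y)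

      -- `U` itself carries no decision procedure; searching the finitely many parameters supplies
      -- one.
      subspace-dec : ∀ {M N} → ∣ X ∣ ↔ Fin M → ∣ Y ∣ ↔ Fin N → ∀ y → Dec (U y)
      subspace-dec X↔ Y↔ y = map′ (λ (x , eq) → subst U eq (sound x)) (complete y)
        (finite-any? X↔ λ x → finite-≟ Y↔ (map-to ⟨$⟩ x) y)

      -- If every vector lay in `U`, the parameters given by `complete` would inject the larger set
      -- into the smaller.
      ∃-outside : ∀ {M N} → ∣ X ∣ ↔ Fin M → ∣ Y ∣ ↔ Fin N → M ℕ.< N → Σ ∣ Y ∣ λ y → ¬ U y
      ∃-outside X↔ Y↔ M<N with finite-any? Y↔ (λ y → ¬? (subspace-dec X↔ Y↔ y))
      ... | yes p = p
      ... | no ¬p = ⊥-elim (Fin.<⇒notInjective M<N λ eq →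
              from-injective Y↔ (h-injective (to-injective X↔ eq)))
        where
        all : ∀ y → U y
        all y = decidable-stable (subspace-dec X↔ Y↔ y) λ ¬Uy → ¬p (y , ¬Uy)
        h-injective : ∀ {y y'} → proj₁ (complete y (all y)) ≡ proj₁ (complete y' (all y')) → y ≡ y'
        h-injective {y} {y'} eq =
          trans (sym (proj₂ (complete y (all y)))) (trans (cong (map-to ⟨$⟩_) eq) (proj₂ (complete y' (all y'))))

  -- From f x + g x' = 0 it follows that f x = g (-x') lies in both images, hence vanishes, and then
  -- g x' vanishes too.
  copair-kernel : ∀ {X X' Y} (f : X ⊸ Y) (g : X' ⊸ Y) →
    TrivialKernel f → TrivialKernel g → (∀ x x' → (f ⟨$⟩ x) ≡ (g ⟨$⟩ x') → (f ⟨$⟩ x) ≡ VectorSpace.𝟘 Y) →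
    TrivialKernel [ f , g ]
  copair-kernel {X} {X'} {Y} f g kf kg disjoint (x , x') eq = cong₂ _,_ (kf x fx≡0) (kg x' gx'≡0)
    where
    open VectorSpace Y
    fx≡0 : (f ⟨$⟩ x) ≡ 𝟘
    fx≡0 = disjoint x (VectorSpace.⊖_ X' x') (trans (inverseˡ-unique _ _ eq) (sym (⊖-homo g x')))
    gx'≡0 : (g ⟨$⟩ x') ≡ 𝟘
    gx'≡0 = trans (sym (identityˡ _)) (trans (cong (_⊕ _) (sym fx≡0)) eq)

  module _ {X X' Y : VectorSpace} {E E' : ∣ Y ∣ → Set}
    (P : Parametrization X Y E) (P' : Parametrization X' Y E')
    (disjoint : ∀ y → E y → E' y → y ≡ VectorSpace.𝟘 Y)
    where
    private
      module P = Parametrization P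
      module P' = Parametrization P'

    abstract
      sum-kernel : TrivialKernel [ P.map-to , P'.map-to ]
      sum-kernel = copair-kernel P.map-to P'.map-to P.kernel P'.kernel
        (λ x x' eq → disjoint _ (P.sound x) (subst E' (sym eq) (P'.sound x')))

      -- The sum is direct, so it has as many vectors as the pairs of parameters; matching the size
      -- of `U`, it exhausts `U`.
      sum-fills : ∀ {Z U N} → Parametrization Z Y U →
        (∣ X ∣ × ∣ X' ∣) ↔ Fin N → ∣ Z ∣ ↔ Fin N →
        (∀ y → E y → U y) → (∀ y → E' y → U y) →
        ∀ y → U y → Σ (∣ X ∣ × ∣ X' ∣) λ x → ([ P.map-to , P'.map-to ] ⟨$⟩ x) ≡ y
      sum-fills Q X×X'↔ Z↔ E⊆U E'⊆U = fill Q Z↔ X×X'↔ [ P.map-to , P'.map-to ] sum-kernel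
        (λ (x , x') → closed-⊕ Q (E⊆U _ (P.sound x)) (E'⊆U _ (P'.sound x')))

  abstract
    -- Since `U` is the direct sum of `E` and `E'`, each vector of `E₀` splits as b + c with b in
    -- `E` and c in `E'`. Setting g = -b makes `E'` contain the graph of `g` over `E₀`. This is what
    -- scales coordinates so that a third subspace becomes a diagonal such as (I,I,0).
    graph-over : ∀ {X Y Z} {E₀ E E' U : ∣ Y ∣ → Set} {N} → let open VectorSpace Y using (_⊕_; 𝟘) in
      (P₀ : Parametrization X Y E₀) → Parametrization X Y E → Parametrization X Y E' →
      Parametrization Z Y U → (∣ X ∣ × ∣ X ∣) ↔ Fin N → ∣ Z ∣ ↔ Fin N →
      (∀ y → E₀ y → U y) → (∀ y → E y → U y) → (∀ y → E' y → U y) →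
      (∀ y → E y → E' y → y ≡ 𝟘) → (∀ y → E₀ y → E' y → y ≡ 𝟘) →
      Σ (X ⊸ Y) λ g → TrivialKernel g × (∀ x → E (g ⟨$⟩ x)) ×
        (∀ x → E' ((Parametrization.map-to P₀ ⟨$⟩ x) ⊕ (g ⟨$⟩ x)))
    graph-over {X} {Y} {E' = E'} P₀ P P' Q X×X↔ Z↔ E₀⊆U E⊆U E'⊆U E∩E' E₀∩E' =
      g , g-kernel , (λ x → P.sound _) , E'-graph
      where
      open VectorSpace Y
      module P₀ = Parametrization P₀
      module P = Parametrization P
      module P' = Parametrization P'
      lifted : Σ (X ⊸ (X ⊗ X)) λ h → ∀ x → ([ P.map-to , P'.map-to ] ⟨$⟩ h ⟨$⟩ x) ≡ (P₀.map-to ⟨$⟩ x)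
      lifted = lift [ P.map-to , P'.map-to ] (sum-kernel P P' E∩E') P₀.map-to
        (λ x → sum-fills P P' E∩E' Q X×X↔ Z↔ E⊆U E'⊆U _ (E₀⊆U _ (P₀.sound x)))
      h : X ⊸ (X ⊗ X)
      h = proj₁ lifted
      g : X ⊸ Y
      g = P.map-to ∘ₗ neg ∘ₗ fst ∘ₗ h
      graph-eq : ∀ x → (P₀.map-to ⟨$⟩ x) ⊕ (g ⟨$⟩ x) ≡ (P'.map-to ⟨$⟩ proj₂ (h ⟨$⟩ x))
      graph-eq x = begin
        (P₀.map-to ⟨$⟩ x) ⊕ (g ⟨$⟩ x)  ≡⟨ cong₂ _⊕_ (sym (proj₂ lifted x)) (⊖-homo P.map-to b) ⟩
        (pb ⊕ p'c) ⊕ ⊖ pb              ≡⟨ cong (_⊕ ⊖ pb) (comm pb p'c) ⟩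
        (p'c ⊕ pb) ⊕ ⊖ pb              ≡⟨ assoc p'c pb (⊖ pb) ⟩
        p'c ⊕ (pb ⊕ ⊖ pb)              ≡⟨ cong (p'c ⊕_) (inverseʳ pb) ⟩
        p'c ⊕ 𝟘                        ≡⟨ identityʳ p'c ⟩
        p'c                            ∎
        where
        open ≡-Reasoning
        b : ∣ X ∣
        b = proj₁ (h ⟨$⟩ x)
        pb p'c : Carrier
        pb = P.map-to ⟨$⟩ b
        p'c = P'.map-to ⟨$⟩ proj₂ (h ⟨$⟩ x)
      E'-graph : ∀ x → E' ((P₀.map-to ⟨$⟩ x) ⊕ (g ⟨$⟩ x))
      E'-graph x = subst E' (sym (graph-eq x)) (P'.sound _)
      g-kernel : TrivialKernel g
      g-kernel x gx≡0 = P₀.kernel x (E₀∩E' _ (P₀.sound x)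
        (subst E' (trans (cong (_ ⊕_) gx≡0) (identityʳ _)) (E'-graph x)))

-- Matrices as linear maps on row vectors.

module Matrices {q : ℕ} (𝔽 : FiniteField q) (n : ℕ) where
  open FiniteField 𝔽
  open Geometry 𝔽 n
  open LinearAlgebra 𝔽

  V⃗ W⃗ : VectorSpace
  V⃗ = 𝔽^ n
  W⃗ = V⃗ ⊗ (V⃗ ⊗ V⃗)

  ⊙ₗ : Mat → V⃗ ⊸ V⃗
  ⊙ₗ = combinationₗ V⃗

  private
    IM-entry : ∀ (f : Fin n → Fin n → F) i j → lookup (lookup (tabulate λ i → tabulate (f i)) i) j ≡ f i j
    IM-entry f i j = trans (cong (λ r → lookup r j) (Vec.lookup∘tabulate (λ i → tabulate (f i)) i))
                           (Vec.lookup∘tabulate (f i) j)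

    -- The entry function of `IM` is local to its definition; unification with `refl` makes it
    -- accessible.
    δ : Σ (Fin n → Fin n → F) λ f → IM ≡ tabulate λ i → tabulate (f i)
    δ = _ , refl

  abstract
    IM-diagonal : ∀ i → lookup (lookup IM i) i ≡ 1#
    IM-diagonal i with i Fin.≟ i | IM-entry (proj₁ δ) i i
    ... | yes _ | eq = eq
    ... | no i≢i | _ = contradiction refl i≢i

    IM-off-diagonal : ∀ i j → i ≢ j → lookup (lookup IM i) j ≡ 0#
    IM-off-diagonal i j i≢j with i Fin.≟ j | IM-entry (proj₁ δ) i j
    ... | yes i≡j | _ = contradiction i≡j i≢j
    ... | no _ | eq = eq

    -- The j-th coordinate is a combination of the entries in column j of `IM` with coefficients x.
    -- Commutativity of the field exchanges the two roles, and the column is a unit vector.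
    ⊙-IM : ∀ x → x ⊙ IM ≡ x
    ⊙-IM x = trans (sym (Vec.tabulate∘lookup (x ⊙ IM))) (trans (Vec.tabulate-cong lemma) (Vec.tabulate∘lookup x))
      where
      column : Fin n → V
      column j = map (λ r → lookup r j) IM
      lemma : ∀ j → lookup (x ⊙ IM) j ≡ lookup x j
      lemma j = begin
        lookup (x ⊙ IM) j                  ≡⟨ combination-homo (coordinate j) x IM ⟩
        combination 𝔽-space x (column j)   ≡⟨ cong (foldr (λ _ → F) _+_ 0#) (Vec.zipWith-comm *-comm x (column j)) ⟩
        combination 𝔽-space (column j) x   ≡⟨ combination-unit 𝔽-space x (column j) j
                                                (trans (Vec.lookup-map j _ IM) (IM-diagonal j))
                                                (λ i j≢i → trans (Vec.lookup-map i _ IM)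
                                                  (IM-off-diagonal i j (j≢i ∘ sym))) ⟩
        lookup x j                         ∎
        where
        open ≡-Reasoning
        open IsCommutativeRing isCommutativeRing using (*-comm)

  toMat : V⃗ ⊸ V⃗ → Mat
  toMat f = map (f ⟨$⟩_) IM

  abstract
    ⊙-toMat : ∀ f x → x ⊙ toMat f ≡ (f ⟨$⟩ x)
    ⊙-toMat f x = trans (sym (combination-homo f x IM)) (cong (f ⟨$⟩_) (⊙-IM x))

    ⊙-0M : ∀ x → x ⊙ 0M ≡ 0v
    ⊙-0M x = trans (cong (x ⊙_) (sym (Vec.map-const IM 0v))) (⊙-toMat 0ₗ x)

    ⊙-·M : ∀ x A X → x ⊙ (A ·M X) ≡ (x ⊙ A) ⊙ X
    ⊙-·M x A X = sym (combination-homo (⊙ₗ X) x A)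

    ⊙-+M : ∀ x A B → x ⊙ (A +M B) ≡ (x ⊙ A) +v (x ⊙ B)
    ⊙-+M = combination-zipWith-⊕ V⃗

    ⊙--M : ∀ x A B → x ⊙ (A -M B) ≡ (x ⊙ A) +v map -_ (x ⊙ B)
    ⊙--M x A B = trans (⊙-+M x A _) (cong ((x ⊙ A) +v_) (sym (combination-homo (neg {V⃗}) x B)))

    Mat-ext : ∀ {A B : Mat} → (∀ x → x ⊙ A ≡ x ⊙ B) → A ≡ B
    Mat-ext {A} {B} eq =
      trans (sym (Vec.tabulate∘lookup A)) (trans (Vec.tabulate-cong row) (Vec.tabulate∘lookup B))
      where
      unit-⊙ : ∀ i (C : Mat) → lookup IM i ⊙ C ≡ lookup C i
      unit-⊙ i C = combination-unit V⃗ C (lookup IM i) i (IM-diagonal i) (IM-off-diagonal i)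
      row : ∀ i → lookup A i ≡ lookup B i
      row i = trans (sym (unit-⊙ i A)) (trans (eq (lookup IM i)) (unit-⊙ i B))

    V↔Fin : V ↔ Fin (q ^ n)
    V↔Fin = Vec↔Fin n

    V×V↔Fin : (V × V) ↔ Fin (q ^ n ℕ.* q ^ n)
    V×V↔Fin = ×↔Fin V↔Fin V↔Fin

    W↔Fin : W ↔ Fin (q ^ n ℕ.* (q ^ n ℕ.* q ^ n))
    W↔Fin = ×↔Fin V↔Fin (×↔Fin V↔Fin V↔Fin)

-- Spread sets from sharply transitive families of matrices.

module SpreadSets {q : ℕ} (𝔽 : FiniteField q) (n : ℕ) where
  open FiniteField 𝔽
  open Geometry 𝔽 n
  open LinearAlgebra 𝔽
  open Matrices 𝔽 n
  open VectorSpace V⃗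

  infix 4 _≟v_
  _≟v_ : DecidableEquality V
  _≟v_ = finite-≟ V↔Fin

  -- The matrices of a spread are first known only through the existence of spread elements, hence
  -- by a predicate in `Set₁`; the record turns such a predicate into a list.
  record SpreadSetOf (P : Mat → Set₁) : Set₁ where
    constructor spread-set-of
    field
      matrices    : List Mat
      isSpreadSet : IsSpreadSet matrices
      sound       : ∀ {A} → A ∈ matrices → P A
      complete    : ∀ {A} → P A → A ∈ matrices

  abstract
    -- A ↦ eA is a bijection from `P` onto the row vectors, so listing the vectors lists the
    -- matrices, q^n of them. Uniqueness at every other nonzero z makes differences nonsingular,
    -- because z (A - B) = 0 means zA = zB.
    spread-set : (P : Mat → Set₁) →
      (∀ {A B} z → z ≢ 0v → P A → P B → z ⊙ A ≡ z ⊙ B → A ≡ B) →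
      (e : V) → e ≢ 0v → (∀ u → Σ Mat λ A → P A × e ⊙ A ≡ u) →
      SpreadSetOf P
    spread-set P P-unique e e≢0 through = spread-set-of 𝐌 (unique , size , nonsingular) sound complete
      where
      element : Fin (q ^ n) → Mat
      element i = proj₁ (through (Inverse.from V↔Fin i))
      e⊙element : ∀ i → e ⊙ element i ≡ Inverse.from V↔Fin i
      e⊙element i = proj₂ (proj₂ (through (Inverse.from V↔Fin i)))
      𝐌 : List Mat
      𝐌 = List.map element (allFin (q ^ n))
      unique : Unique 𝐌
      unique = Unique.map⁺
        (λ {i} {j} eq → from-injective V↔Fin
          (trans (sym (e⊙element i)) (trans (cong (e ⊙_) eq) (e⊙element j))))
        (Unique.allFin⁺ _)
      size : length 𝐌 ≡ q ^ n
      size = trans (List.length-map element (allFin (q ^ n))) (List.length-tabulate {n = q ^ n} (λ i → i))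
      sound : ∀ {A} → A ∈ 𝐌 → P A
      sound A∈ with List.∈-map⁻ element A∈
      ... | i , _ , refl = proj₁ (proj₂ (through (Inverse.from V↔Fin i)))
      complete : ∀ {A} → P A → A ∈ 𝐌
      complete {A} PA = subst (_∈ 𝐌)
        (P-unique e e≢0 (sound i∈) PA (trans (e⊙element i) (Inverse.strictlyInverseʳ V↔Fin (e ⊙ A)))) i∈
        where
        i : Fin (q ^ n)
        i = Inverse.to V↔Fin (e ⊙ A)
        i∈ : element i ∈ 𝐌
        i∈ = List.∈-map⁺ element (List.∈-allFin i)
      nonsingular : ∀ A B → A ∈ 𝐌 → B ∈ 𝐌 → A ≢ B → Nonsingular (A -M B)
      nonsingular A B A∈ B∈ A≢B x eq with x ≟v 0v
      ... | yes x≡0 = x≡0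
      ... | no x≢0 = contradiction
              (P-unique x x≢0 (sound A∈) (sound B∈)
                (x∙y⁻¹≈ε⇒x≈y _ _ (trans (sym (⊙--M x A B)) eq)))
              A≢B

-- The spread in coordinates adapted to the three normal elements.

-- The spread is an indexed family because in the application an index is an element of the given
-- spread and `el` is its preimage under the coordinate map.
module Coordinatised {q : ℕ} (𝔽 : FiniteField q) (n : ℕ)
  (e : Geometry.V 𝔽 n) (e≢0 : e ≢ Geometry.0v 𝔽 n)
  (I : Set₁) (el : I → Geometry.Pred 𝔽 n)
  (param : ∀ i → LinearAlgebra.Parametrization 𝔽
    (Matrices.V⃗ 𝔽 n) (Matrices.W⃗ 𝔽 n) (el i))
  (cover : ∀ w → Geometry.NonZeroW 𝔽 n w → Σ I λ i → el i w)
  (meet : ∀ i j w → Geometry.NonZeroW 𝔽 n w → el i w → el j w →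
    Geometry._≐_ 𝔽 n (el i) (el j))
  where
  open FiniteField 𝔽
  open Geometry 𝔽 n
  open LinearAlgebra 𝔽
  open Matrices 𝔽 n
  open SpreadSets 𝔽 n
  open VectorSpace V⃗ hiding (Carrier)

  Normal : I → Set₁
  Normal i = ∀ j → ¬ (el i ≐ el j) → ∀ w → NonZeroW w → Join (el i) (el j) w →
    Σ I λ k → el k ⊆ Join (el i) (el j) × el k w

  -- In the notation of the statement, i₁, …, i₅ are (0,I,0), (I,0,0), (I,I,0), (0,0,I), (I,0,I).
  module Framed
    (i₁ i₂ i₃ i₄ i₅ : I)
    (∋i₁ : ∀ x → el i₁ (0v , x , 0v)) (∋i₂ : ∀ x → el i₂ (x , 0v , 0v))
    (∋i₃ : ∀ x → el i₃ (x , x , 0v)) (∋i₄ : ∀ x → el i₄ (0v , 0v , x))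
    (∋i₅ : ∀ x → el i₅ (x , 0v , x))
    (normal₁ : Normal i₁) (normal₂ : Normal i₂) (normal₃ : Normal i₃)
    where

    rowₗ : Mat → Mat → Mat → V⃗ ⊸ W⃗
    rowₗ A B C = ⟨ ⊙ₗ A , ⟨ ⊙ₗ B , ⊙ₗ C ⟩ ⟩

    abstract
      -- One inclusion is enough, both sides having q^n vectors.
      ≐-row : ∀ i A B C → TrivialKernel (rowₗ A B C) → (∀ x → el i (rowₗ A B C ⟨$⟩ x)) → el i ≐ RowSp A B C
      ≐-row i A B C ker ∋ =
        (λ w iw → let x , eq = fill (param i) V↔Fin V↔Fin (rowₗ A B C) ker ∋ w iw in x , sym eq) ,
        λ { _ (x , refl) → ∋ x }

      affine-point : ∀ A B x → RowSp A B IM (x ⊙ A , x ⊙ B , x)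
      affine-point A B x = x , cong (λ t → x ⊙ A , x ⊙ B , t) (sym (⊙-IM x))

      affine-coords : ∀ A B w → RowSp A B IM w →
        proj₁ w ≡ proj₂ (proj₂ w) ⊙ A × proj₁ (proj₂ w) ≡ proj₂ (proj₂ w) ⊙ B
      affine-coords A B (u , v , z) (x , eq) =
        trans (cong proj₁ eq) (cong (_⊙ A) x≡z) , trans (cong (proj₁ ∘ proj₂) eq) (cong (_⊙ B) x≡z)
        where
        x≡z : x ≡ z
        x≡z = trans (sym (⊙-IM x)) (sym (cong (proj₂ ∘ proj₂) eq))

      infinite-point : ∀ C x → RowSp IM C 0M (x , x ⊙ C , 0v)
      infinite-point C x = x , cong₂ (λ s t → s , x ⊙ C , t) (sym (⊙-IM x)) (sym (⊙-0M x))

      infinite-coords : ∀ C w → RowSp IM C 0M w →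
        proj₁ (proj₂ w) ≡ proj₁ w ⊙ C × proj₂ (proj₂ w) ≡ 0v
      infinite-coords C (u , v , z) (x , eq) =
        trans (cong (proj₁ ∘ proj₂) eq) (cong (_⊙ C) (trans (sym (⊙-IM x)) (sym (cong proj₁ eq)))) ,
        trans (cong (proj₂ ∘ proj₂) eq) (⊙-0M x)

    record Affine (A B : Mat) : Set₁ where
      constructor element
      field
        index : I
        row   : el index ≐ RowSp A B IM

    record Infinite (C : Mat) : Set₁ where
      constructor element
      field
        index : I
        row   : el index ≐ RowSp IM C 0M

    abstract
      affine-row : ∀ i A B → (∀ x → el i (x ⊙ A , x ⊙ B , x)) → el i ≐ RowSp A B IM
      affine-row i A B ∋ = ≐-row i A B IM
        (λ x eq → trans (sym (⊙-IM x)) (cong (proj₂ ∘ proj₂) eq))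
        (λ x → subst (λ t → el i (x ⊙ A , x ⊙ B , t)) (sym (⊙-IM x)) (∋ x))

      infinite-row : ∀ i C → (∀ x → el i (x , x ⊙ C , 0v)) → el i ≐ RowSp IM C 0M
      infinite-row i C ∋ = ≐-row i IM C 0M
        (λ x eq → trans (sym (⊙-IM x)) (cong proj₁ eq))
        (λ x → subst (λ s → el i (s , x ⊙ C , x ⊙ 0M)) (sym (⊙-IM x))
          (subst (λ t → el i (x , x ⊙ C , t)) (sym (⊙-0M x)) (∋ x)))

      i₁≐ : el i₁ ≐ RowSp 0M IM 0M
      i₁≐ = ≐-row i₁ 0M IM 0M
        (λ x eq → trans (sym (⊙-IM x)) (cong (proj₁ ∘ proj₂) eq))
        (λ x → subst (λ s → el i₁ (s , x ⊙ IM , s)) (sym (⊙-0M x)) (∋i₁ (x ⊙ IM)))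

      i₂≐ : el i₂ ≐ RowSp IM 0M 0M
      i₂≐ = infinite-row i₂ 0M λ x → subst (λ t → el i₂ (x , t , 0v)) (sym (⊙-0M x)) (∋i₂ x)

      i₃≐ : el i₃ ≐ RowSp IM IM 0M
      i₃≐ = infinite-row i₃ IM λ x → subst (λ t → el i₃ (x , t , 0v)) (sym (⊙-IM x)) (∋i₃ x)

      i₄≐ : el i₄ ≐ RowSp 0M 0M IM
      i₄≐ = affine-row i₄ 0M 0M λ x → subst (λ t → el i₄ (t , t , x)) (sym (⊙-0M x)) (∋i₄ x)

      i₅≐ : el i₅ ≐ RowSp IM 0M IM
      i₅≐ = affine-row i₅ IM 0M λ x →
        subst (λ s → el i₅ (s , x ⊙ 0M , x)) (sym (⊙-IM x))
          (subst (λ t → el i₅ (x , t , x)) (sym (⊙-0M x)) (∋i₅ x))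

      i₁-coords : ∀ w → el i₁ w → proj₁ w ≡ 0v × proj₂ (proj₂ w) ≡ 0v
      i₁-coords w i₁w =
        let x , eq = proj₁ i₁≐ w i₁w
        in trans (cong proj₁ eq) (⊙-0M x) , trans (cong (proj₂ ∘ proj₂) eq) (⊙-0M x)

      join⊆Π∞ : Join (el i₁) (el i₂) ⊆ Π∞
      join⊆Π∞ w (a , b , i₁a , i₂b , w≡) =
        trans (cong (proj₂ ∘ proj₂) w≡)
          (trans (cong₂ _+v_ (proj₂ (i₁-coords a i₁a)) (proj₂ (infinite-coords 0M b (proj₁ i₂≐ b i₂b))))
                 (identityˡ 0v))

      Π∞⊆join : Π∞ ⊆ Join (el i₁) (el i₂)
      Π∞⊆join (u , v , z) z≡0 = (0v , v , 0v) , (u , 0v , 0v) , ∋i₁ v , ∋i₂ u ,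
        cong₂ _,_ (sym (identityˡ u)) (cong₂ _,_ (sym (identityʳ v)) (trans z≡0 (sym (identityˡ 0v))))

      i₁≢i₂ : ¬ (el i₁ ≐ el i₂)
      i₁≢i₂ (_ , i₂⊆i₁) = e≢0 (proj₁ (i₁-coords (e , 0v , 0v) (i₂⊆i₁ _ (∋i₂ e))))

      -- `Π∞` is the join of `i₁` and `i₂`, so normality of `i₁` partitions it: the element through
      -- a nonzero vector of `Π∞` stays inside.
      at-infinity : ∀ i w → NonZeroW w → Π∞ w → el i w → el i ⊆ Π∞
      at-infinity i w w≢0 w∈Π∞ iw w' iw' =
        let k , k⊆ , kw = normal₁ i₂ i₁≢i₂ w w≢0 (Π∞⊆join w w∈Π∞)
        in join⊆Π∞ w' (k⊆ w' (proj₁ (meet i k w w≢0 iw kw) w' iw'))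

    module _ (i : I) where
      open Parametrization (param i)

      abstract
        -- A projection to n coordinates that is injective on the element is bijective on it by
        -- counting, so the element is a graph over these coordinates.
        section : (π : W⃗ ⊸ V⃗) → (∀ w → el i w → π ⟨$⟩ w ≡ 0v → w ≡ 0W) →
          Σ (V⃗ ⊸ W⃗) λ s → (∀ x → π ⟨$⟩ s ⟨$⟩ x ≡ x) × (∀ x → el i (s ⟨$⟩ x))
        section π ker =
          let g , πg≡ = right-inverse V↔Fin V↔Fin (π ∘ₗ map-to) λ x eq → kernel x (ker _ (sound x) eq)
          in map-to ∘ₗ g , πg≡ , λ x → sound _

        -- An element with a point outside `Π∞` meets `Π∞` only in 0, so its third coordinate is
        -- injective and the other two are linear functions of it.
        affine : ∀ w → el i w → ¬ Π∞ w → Σ Mat λ A → Σ Mat λ B → el i ≐ RowSp A B IM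
        affine w iw w∉Π∞ =
          let s , πs≡ , i∋s = section (snd ∘ₗ snd) λ w' iw' w'∈Π∞ →
                decidable-stable (finite-≟ W↔Fin w' 0W) λ w'≢0 →
                  w∉Π∞ (at-infinity i w' w'≢0 w'∈Π∞ iw' w iw)
              A = toMat (fst ∘ₗ s)
              B = toMat (fst ∘ₗ snd ∘ₗ s)
          in A , B , affine-row i A B λ x →
               subst (el i)
                 (cong₂ _,_ (sym (⊙-toMat (fst ∘ₗ s) x)) (cong₂ _,_ (sym (⊙-toMat (fst ∘ₗ snd ∘ₗ s) x)) (πs≡ x)))
                 (i∋s x)

        -- Within `Π∞` a nonzero vector with first coordinate 0 lies on `i₁`. An element having one
        -- would be `i₁`, against u ≠ 0, so the first coordinate is injective here.
        infinite : ∀ {u v z} → el i (u , v , z) → u ≢ 0v → z ≡ 0v → Σ Mat λ C → el i ≐ RowSp IM C 0M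
        infinite {u} {v} {z} iw u≢0 z≡0 =
          let s , πs≡ , i∋s = section fst λ (u' , v' , z') iw' u'≡0 →
                decidable-stable (finite-≟ W↔Fin (u' , v' , z') 0W) λ w'≢0 →
                  let z'≡0 = i⊆Π∞ _ iw'
                      i₁≐i = meet i₁ i _ w'≢0
                        (subst (el i₁) (cong₂ (λ s t → s , v' , t) (sym u'≡0) (sym z'≡0)) (∋i₁ v')) iw'
                  in u≢0 (proj₁ (i₁-coords (u , v , z) (proj₂ i₁≐i _ iw)))
              C = toMat (fst ∘ₗ snd ∘ₗ s)
          in C , infinite-row i C λ x →
               subst (el i)
                 (cong₂ _,_ (πs≡ x) (cong₂ _,_ (sym (⊙-toMat (fst ∘ₗ snd ∘ₗ s) x)) (i⊆Π∞ _ (i∋s x))))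
                 (i∋s x)
          where
          i⊆Π∞ : el i ⊆ Π∞
          i⊆Π∞ = at-infinity i _ (u≢0 ∘ cong proj₁) z≡0 iw

        some-point : Σ W λ w → NonZeroW w × el i w
        some-point = map-to ⟨$⟩ e , (λ eq → e≢0 (kernel e eq)) , sound e

        infinite-or-i₁ : el i ⊆ Π∞ → (Σ Mat λ C → el i ≐ RowSp IM C 0M) ⊎ el i ≐ el i₁
        infinite-or-i₁ i⊆Π∞ with some-point
        ... | (u , v , z) , w≢0 , iw with u ≟v 0v
        ...   | no u≢0 = inj₁ (infinite iw u≢0 (i⊆Π∞ _ iw))
        ...   | yes refl with i⊆Π∞ _ iw
        ...     | refl = inj₂ (meet i i₁ _ w≢0 iw (∋i₁ v))

        affine-or-infinite : (Σ Mat λ A → Σ Mat λ B → el i ≐ RowSp A B IM) ⊎ el i ⊆ Π∞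
        affine-or-infinite with some-point
        ... | (u , v , z) , w≢0 , iw with z ≟v 0v
        ...   | no z≢0 = inj₁ (affine _ iw z≢0)
        ...   | yes z≡0 = inj₂ (at-infinity i _ w≢0 z≡0 iw)

    abstract
      -- The two elements share the nonzero vector (zA, zB, z), hence coincide.
      affine-unique : ∀ {A B A' B'} → Affine A B → Affine A' B' → ∀ z → z ≢ 0v →
        z ⊙ A ≡ z ⊙ A' → z ⊙ B ≡ z ⊙ B' → A ≡ A' × B ≡ B'
      affine-unique {A} {B} {A'} {B'} (element i i≐) (element j j≐) z z≢0 eqA eqB =
        Mat-ext (proj₁ ∘ coords) , Mat-ext (proj₂ ∘ coords)
        where
        i≐j : el i ≐ el j
        i≐j = meet i j (z ⊙ A , z ⊙ B , z) (z≢0 ∘ cong (proj₂ ∘ proj₂))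
          (proj₂ i≐ _ (affine-point A B z))
          (proj₂ j≐ _ (subst (RowSp A' B' IM) (cong₂ (λ s t → s , t , z) (sym eqA) (sym eqB))
            (affine-point A' B' z)))
        coords : ∀ x → x ⊙ A ≡ x ⊙ A' × x ⊙ B ≡ x ⊙ B'
        coords x = affine-coords A' B' (x ⊙ A , x ⊙ B , x) (proj₁ j≐ _ (proj₁ i≐j _ (proj₂ i≐ _ (affine-point A B x))))

      infinite-unique : ∀ {C C'} z → z ≢ 0v → Infinite C → Infinite C' → z ⊙ C ≡ z ⊙ C' → C ≡ C'
      infinite-unique {C} {C'} z z≢0 (element i i≐) (element j j≐) eq = Mat-ext λ x →
        proj₁ (infinite-coords C' (x , x ⊙ C , 0v) (proj₁ j≐ _ (proj₁ i≐j _ (proj₂ i≐ _ (infinite-point C x)))))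
        where
        i≐j : el i ≐ el j
        i≐j = meet i j (z , z ⊙ C , 0v) (z≢0 ∘ cong proj₁)
          (proj₂ i≐ _ (infinite-point C z))
          (proj₂ j≐ _ (subst (λ t → RowSp IM C' 0M (z , t , 0v)) (sym eq) (infinite-point C' z)))

      affine-through : ∀ u v z → z ≢ 0v → Σ Mat λ A → Σ Mat λ B → Affine A B × z ⊙ A ≡ u × z ⊙ B ≡ v
      affine-through u v z z≢0 =
        let i , iw = cover (u , v , z) (z≢0 ∘ cong (proj₂ ∘ proj₂))
            A , B , i≐ = affine i _ iw z≢0
            eqA , eqB = affine-coords A B (u , v , z) (proj₁ i≐ _ iw)
        in A , B , (element i i≐) , sym eqA , sym eqB

      infinite-through : ∀ u v → u ≢ 0v → Σ Mat λ C → Infinite C × u ⊙ C ≡ v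
      infinite-through u v u≢0 =
        let i , iw = cover (u , v , 0v) (u≢0 ∘ cong proj₁)
            C , i≐ = infinite i iw u≢0 refl
        in C , (element i i≐) , sym (proj₁ (infinite-coords C (u , v , 0v) (proj₁ i≐ _ iw)))

    -- Expresses that (A',B',I) lies in the join of (P,Q,0) and (A,B,I); the essential point is that
    -- one t serves both coordinates.
    Graph : (P Q A B A' B' : Mat) → Set
    Graph P Q A B A' B' =
      ∀ x → Σ V λ t → x ⊙ A' ≡ (t ⊙ P) +v (x ⊙ A) × x ⊙ B' ≡ (t ⊙ Q) +v (x ⊙ B)

    -- The element through (zA + yP, zB + yQ, z) inside the join of the normal element (P,Q,0) and (A,B,I).
    record Shift (P Q A B : Mat) (z y : V) : Set₁ where
      constructor shifted
      field
        A' B'     : Mat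
        at-point₁ : z ⊙ A' ≡ (y ⊙ P) +v (z ⊙ A)
        at-point₂ : z ⊙ B' ≡ (y ⊙ Q) +v (z ⊙ B)
        affine'   : Affine A' B'
        graph     : Graph P Q A B A' B'

    abstract
      shift : ∀ {i} P Q {A B} z → Normal i → el i ≐ RowSp P Q 0M → Affine A B → z ≢ 0v → ∀ y →
        Shift P Q A B z y
      shift {i} P Q {A} {B} z normal i≐ (element j j≐) z≢0 y =
        from-join (normal j distinct w (z≢0 ∘ cong (proj₂ ∘ proj₂)) w∈join)
        where
        w : W
        w = (y ⊙ P) +v (z ⊙ A) , (y ⊙ Q) +v (z ⊙ B) , z
        w∈join : Join (el i) (el j) w
        w∈join = (y ⊙ P , y ⊙ Q , 0v) , (z ⊙ A , z ⊙ B , z) ,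
          proj₂ i≐ _ (y , cong (λ t → y ⊙ P , y ⊙ Q , t) (sym (⊙-0M y))) ,
          proj₂ j≐ _ (affine-point A B z) ,
          cong (λ t → proj₁ w , proj₁ (proj₂ w) , t) (sym (identityˡ z))
        distinct : ¬ (el i ≐ el j)
        distinct (_ , j⊆i) =
          let x , eq = proj₁ i≐ _ (j⊆i _ (proj₂ j≐ _ (affine-point A B z)))
          in z≢0 (trans (cong (proj₂ ∘ proj₂) eq) (⊙-0M x))
        decompose : ∀ a b x → Join (el i) (el j) (a , b , x) →
          Σ V λ t → a ≡ (t ⊙ P) +v (x ⊙ A) × b ≡ (t ⊙ Q) +v (x ⊙ B)
        decompose a b x ((q₁ , q₂ , q₃) , (p₁ , p₂ , p₃) , iq , jp , eq) =
          finish (proj₁ i≐ (q₁ , q₂ , q₃) iq) (affine-coords A B (p₁ , p₂ , p₃) (proj₁ j≐ _ jp))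
          where
          finish : RowSp P Q 0M (q₁ , q₂ , q₃) → p₁ ≡ p₃ ⊙ A × p₂ ≡ p₃ ⊙ B →
            Σ V λ t → a ≡ (t ⊙ P) +v (x ⊙ A) × b ≡ (t ⊙ Q) +v (x ⊙ B)
          finish (t , q≡) (eqA , eqB) =
            t , trans (cong proj₁ eq) (cong₂ _+v_ (cong proj₁ q≡) (trans eqA (cong (_⊙ A) (sym x≡p₃))))
              , trans (cong (proj₁ ∘ proj₂) eq)
                  (cong₂ _+v_ (cong (proj₁ ∘ proj₂) q≡) (trans eqB (cong (_⊙ B) (sym x≡p₃))))
            where
            x≡p₃ : x ≡ p₃
            x≡p₃ = trans (cong (proj₂ ∘ proj₂) eq)
              (trans (cong (_+v p₃) (trans (cong (proj₂ ∘ proj₂) q≡) (⊙-0M t))) (identityˡ p₃))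
        from-join : (Σ I λ k → el k ⊆ Join (el i) (el j) × el k w) → Shift P Q A B z y
        from-join (k , k⊆ , kw) = from-affine (affine k w kw z≢0)
          where
          from-affine : (Σ Mat λ A' → Σ Mat λ B' → el k ≐ RowSp A' B' IM) → Shift P Q A B z y
          from-affine (A' , B' , k≐) = from-coords (affine-coords A' B' w (proj₁ k≐ w kw))
            where
            from-coords : proj₁ w ≡ z ⊙ A' × proj₁ (proj₂ w) ≡ z ⊙ B' → Shift P Q A B z y
            from-coords (eqA , eqB) = shifted A' B' (sym eqA) (sym eqB) (element k k≐)
              λ x → decompose (x ⊙ A') (x ⊙ B') x (k⊆ _ (proj₂ k≐ _ (affine-point A' B' x)))

      ⊖-shift : ∀ a v → ((a +v (⊖ v)) +v v) ≡ a
      ⊖-shift a v = trans (assoc a (⊖ v) v) (trans (cong (a +v_) (inverseˡ v)) (identityʳ a))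

      0M-+ : ∀ t v → (t ⊙ 0M) +v v ≡ v
      0M-+ t v = trans (cong (_+v v) (⊙-0M t)) (identityˡ v)

      -- In the join with (0,I,0) the first matrix cannot move, since the term tP vanishes; the
      -- second takes any prescribed value at `e`.
      shift₁ : ∀ {A B} → Affine A B → ∀ y →
        Σ Mat λ B' → Affine A B' × e ⊙ B' ≡ y +v (e ⊙ B)
      shift₁ {A} {B} AB y = fix (shift 0M IM e normal₁ i₁≐ AB e≢0 y)
        where
        fixed : ∀ x {a} {Z : V → Set} → (Σ V λ t → a ≡ (t ⊙ 0M) +v (x ⊙ A) × Z t) → a ≡ x ⊙ A
        fixed x (t , eq , _) = trans eq (0M-+ t (x ⊙ A))
        fix : Shift 0M IM A B e y → Σ Mat λ B' → Affine A B' × e ⊙ B' ≡ y +v (e ⊙ B)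
        fix (shifted A' B' _ eqB A'B' graph) =
          B' , subst (λ X → Affine X B') (Mat-ext {A'} {A} λ x → fixed x (graph x)) A'B' ,
          trans eqB (cong (_+v (e ⊙ B)) (⊙-IM y))

      shift₂ : ∀ {A B} → Affine A B → ∀ y →
        Σ Mat λ A' → Affine A' B × e ⊙ A' ≡ y +v (e ⊙ A)
      shift₂ {A} {B} AB y = fix (shift IM 0M e normal₂ i₂≐ AB e≢0 y)
        where
        fixed : ∀ x {b} {Z : V → Set} → (Σ V λ t → Z t × b ≡ (t ⊙ 0M) +v (x ⊙ B)) → b ≡ x ⊙ B
        fixed x (t , _ , eq) = trans eq (0M-+ t (x ⊙ B))
        fix : Shift IM 0M A B e y → Σ Mat λ A' → Affine A' B × e ⊙ A' ≡ y +v (e ⊙ A)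
        fix (shifted A' B' eqA _ A'B' graph) =
          A' , subst (Affine A') (Mat-ext {B'} {B} λ x → fixed x (graph x)) A'B' ,
          trans eqA (cong (_+v (e ⊙ A)) (⊙-IM y))

      vary-second : ∀ {A B} → Affine A B → ∀ v → Σ Mat λ B' → Affine A B' × e ⊙ B' ≡ v
      vary-second {A} {B} AB v = case shift₁ AB (v +v (⊖ (e ⊙ B))) of λ
        { (B' , AB' , eq) → B' , AB' , trans eq (⊖-shift v (e ⊙ B)) }

      vary-first : ∀ {A B} → Affine A B → ∀ u → Σ Mat λ A' → Affine A' B × e ⊙ A' ≡ u
      vary-first {A} {B} AB u = case shift₂ AB (u +v (⊖ (e ⊙ A))) of λ
        { (A' , A'B , eq) → A' , A'B , trans eq (⊖-shift u (e ⊙ A)) }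

      -- Moving B until it agrees with B' at `e`, and A' until it agrees with A there, gives two
      -- elements through (eA, eB', e). They are equal, so the pairs (A,B) form a full product M₁ ×
      -- M₂.
      mix : ∀ {A B A' B'} → Affine A B → Affine A' B' → Affine A B'
      mix {A} {B} {A'} {B'} AB A'B' = combine (vary-second AB (e ⊙ B')) (vary-first A'B' (e ⊙ A))
        where
        combine : (Σ Mat λ B″ → Affine A B″ × e ⊙ B″ ≡ e ⊙ B') →
          (Σ Mat λ A″ → Affine A″ B' × e ⊙ A″ ≡ e ⊙ A) → Affine A B'
        combine (B″ , AB″ , eqB) (A″ , A″B' , eqA) =
          subst (Affine A) (proj₂ (affine-unique AB″ A″B' e e≢0 (sym eqA) eqB)) AB″

    -- Closure under addition and equality of the two coordinate sets.

    origin : Affine 0M 0M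
    origin = element i₄ i₄≐

    abstract
      zero-first : ∀ {A B} → Affine A B → ∀ z → z ≢ 0v → z ⊙ A ≡ 0v → A ≡ 0M
      zero-first AB z z≢0 eq =
        proj₁ (affine-unique (mix AB origin) origin z z≢0 (trans eq (sym (⊙-0M z))) refl)

      zero-second : ∀ {A B} → Affine A B → ∀ z → z ≢ 0v → z ⊙ B ≡ 0v → B ≡ 0M
      zero-second AB z z≢0 eq =
        proj₂ (affine-unique (mix origin AB) origin z z≢0 refl (trans eq (sym (⊙-0M z))))

      ⊖-cancel : ∀ v → ((⊖ v) ⊙ IM) +v v ≡ 0v
      ⊖-cancel v = trans (cong (_+v v) (⊙-IM (⊖ v))) (inverseˡ v)

      swap-shift : ∀ {a b c d} t → d ≡ (t ⊙ IM) +v b → c ≡ (t ⊙ IM) +v a → c ≡ 0v → d +v a ≡ b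
      swap-shift {a} {b} {c} {d} t eqD eqC c≡0 = begin
        d +v a                   ≡⟨ cong (_+v a) (trans eqD (comm (t ⊙ IM) b)) ⟩
        (b +v (t ⊙ IM)) +v a     ≡⟨ assoc b (t ⊙ IM) a ⟩
        b +v ((t ⊙ IM) +v a)     ≡⟨ cong (b +v_) (trans (sym eqC) c≡0) ⟩
        b +v 0v                  ≡⟨ identityʳ b ⟩
        b                        ∎
        where open ≡-Reasoning

    -- Written as D + A = B on vectors, so that no negation of matrices enters the equations.
    _−_≈_ : Mat → Mat → Mat → Set
    B − A ≈ D = ∀ x → (x ⊙ D) +v (x ⊙ A) ≡ x ⊙ B

    abstract
      -- In the join with (I,I,0) both matrices move by the same t. The shift by -eA annihilates the
      -- first matrix at `e`, hence altogether; thus t = -xA for every x and the second matrix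
      -- becomes B - A.
      difference₂ : ∀ {A B} → Affine A B → Σ Mat λ D → Affine 0M D × B − A ≈ D
      difference₂ {A} {B} AB = finish (shift IM IM e normal₃ i₃≐ AB e≢0 (⊖ (e ⊙ A)))
        where
        read-off : ∀ {A' D} → A' ≡ 0M → Affine A' D → Graph IM IM A B A' D →
          Σ Mat λ D → Affine 0M D × B − A ≈ D
        read-off {D = D} refl 0D graph = D , 0D , λ x → case graph x of λ
          { (t , 0≡ , eqD) → swap-shift t eqD 0≡ (⊙-0M x) }
        finish : Shift IM IM A B e (⊖ (e ⊙ A)) → Σ Mat λ D → Affine 0M D × B − A ≈ D
        finish (shifted A' D eqA _ A'D graph) =
          read-off (zero-first A'D e e≢0 (trans eqA (⊖-cancel (e ⊙ A)))) A'D graph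

      difference₁ : ∀ {A B} → Affine A B → Σ Mat λ D → Affine D 0M × A − B ≈ D
      difference₁ {A} {B} AB = finish (shift IM IM e normal₃ i₃≐ AB e≢0 (⊖ (e ⊙ B)))
        where
        read-off : ∀ {D B'} → B' ≡ 0M → Affine D B' → Graph IM IM A B D B' →
          Σ Mat λ D → Affine D 0M × A − B ≈ D
        read-off {D} refl D0 graph = D , D0 , λ x → case graph x of λ
          { (t , eqD , 0≡) → swap-shift t eqD 0≡ (⊙-0M x) }
        finish : Shift IM IM A B e (⊖ (e ⊙ B)) → Σ Mat λ D → Affine D 0M × A − B ≈ D
        finish (shifted D B' _ eqB DB' graph) =
          read-off (zero-second DB' e e≢0 (trans eqB (⊖-cancel (e ⊙ B)))) DB' graph

    InM : Mat → Set₁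
    InM A = Affine A 0M

    -- A + A' = A − (0 − A'), where 0 − A' is a second coordinate and can therefore be combined with A.
    abstract
      InM-+ : ∀ {A A'} → InM A → InM A' → InM (A +M A')
      InM-+ {A} {A'} A∈ A'∈ = step (difference₂ A'∈)
        where
        step : (Σ Mat λ D → Affine 0M D × 0M − A' ≈ D) → InM (A +M A')
        step (D , 0D , D+A'≡0) = conclude (difference₁ (mix A∈ 0D))
          where
          conclude : (Σ Mat λ S → Affine S 0M × A − D ≈ S) → InM (A +M A')
          conclude (S , S∈ , S+D≡A) = subst InM (Mat-ext λ x → begin
            x ⊙ S                                ≡⟨ identityʳ (x ⊙ S) ⟨
            (x ⊙ S) +v 0v                        ≡⟨ cong ((x ⊙ S) +v_) (trans (D+A'≡0 x) (⊙-0M x)) ⟨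
            (x ⊙ S) +v ((x ⊙ D) +v (x ⊙ A'))     ≡⟨ assoc (x ⊙ S) (x ⊙ D) (x ⊙ A') ⟨
            ((x ⊙ S) +v (x ⊙ D)) +v (x ⊙ A')     ≡⟨ cong (_+v (x ⊙ A')) (S+D≡A x) ⟩
            (x ⊙ A) +v (x ⊙ A')                  ≡⟨ ⊙-+M x A A' ⟨
            x ⊙ (A +M A')                        ∎) S∈
            where open ≡-Reasoning

      InM-through : ∀ u → Σ Mat λ A → InM A × e ⊙ A ≡ u
      InM-through = vary-first origin

      InM-unique : ∀ {A B} z → z ≢ 0v → InM A → InM B → z ⊙ A ≡ z ⊙ B → A ≡ B
      InM-unique z z≢0 A∈ B∈ eq = proj₁ (affine-unique A∈ B∈ z z≢0 eq refl)

      -- The candidate is the matrix of M with value -eA at `e`. Its sum with A is again in M and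
      -- vanishes at `e`, so it is zero.
      InM-neg : ∀ {A} → InM A → Σ Mat λ N → InM N × (∀ x → (x ⊙ N) +v (x ⊙ A) ≡ 0v)
      InM-neg {A} A∈ = case InM-through (⊖ (e ⊙ A)) of λ
        { (N , N∈ , eN≡) → N , N∈ , λ x →
            trans (sym (⊙-+M x N A)) (trans (cong (x ⊙_) (N+A≡0 N N∈ eN≡)) (⊙-0M x)) }
        where
        N+A≡0 : ∀ N → InM N → e ⊙ N ≡ ⊖ (e ⊙ A) → N +M A ≡ 0M
        N+A≡0 N N∈ eN≡ = zero-first (InM-+ N∈ A∈) e e≢0
          (trans (⊙-+M e N A) (trans (cong (_+v (e ⊙ A)) eN≡) (inverseˡ (e ⊙ A))))

      cancel : ∀ {A B C : Mat} → (∀ x → (x ⊙ A) +v (x ⊙ C) ≡ 0v) → (∀ x → (x ⊙ B) +v (x ⊙ C) ≡ 0v) → A ≡ B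
      cancel {A} {B} {C} A+C≡0 B+C≡0 = Mat-ext λ x →
        ∙-cancelʳ (x ⊙ C) (x ⊙ A) (x ⊙ B) (trans (A+C≡0 x) (sym (B+C≡0 x)))

      -- -A is a first coordinate, paired with the second coordinate 0, and the difference 0 - (-A)
      -- = A is a second coordinate.
      first⇒second : ∀ {A} → InM A → Affine 0M A
      first⇒second {A} A∈ = case InM-neg A∈ of λ
        { (N , N∈ , N+A≡0) → case difference₂ N∈ of λ
          { (D , 0D , D+N≡0) → subst (Affine 0M)
              (cancel {D} {A} {N} (λ x → trans (D+N≡0 x) (⊙-0M x))
                (λ x → trans (comm (x ⊙ A) (x ⊙ N)) (N+A≡0 x)))
              0D } }

      -- The difference 0 - B is a first coordinate, and first coordinates are closed under
      -- negation.
      second⇒first : ∀ {B} → Affine 0M B → InM B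
      second⇒first {B} 0B = case difference₁ 0B of λ
        { (D , D∈ , D+B≡0) → case InM-neg D∈ of λ
          { (N , N∈ , N+D≡0) → subst InM
              (cancel {N} {B} {D} N+D≡0
                (λ x → trans (comm (x ⊙ B) (x ⊙ D)) (trans (D+B≡0 x) (⊙-0M x))))
              N∈ } }

      affine⇔ : ∀ {A B} → InM A → InM B → Affine A B
      affine⇔ A∈ B∈ = mix A∈ (first⇒second B∈)

      affine⇒InM : ∀ {A B} → Affine A B → InM A × InM B
      affine⇒InM AB = mix AB origin , second⇒first (mix origin AB)

      spread-M : SpreadSetOf InM
      spread-M = spread-set InM InM-unique e e≢0 InM-through

      spread-M₀ : SpreadSetOf Infinite
      spread-M₀ = spread-set Infinite infinite-unique e e≢0 λ u → infinite-through e u e≢0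

    open SpreadSetOf spread-M public
      renaming (matrices to 𝐌; isSpreadSet to 𝐌-isSpreadSet; sound to ∈𝐌⇒; complete to ⇒∈𝐌)
    open SpreadSetOf spread-M₀ public
      renaming (matrices to 𝐌₀; isSpreadSet to 𝐌₀-isSpreadSet; sound to ∈𝐌₀⇒; complete to ⇒∈𝐌₀)

    IM∈𝐌 : IM ∈ 𝐌
    IM∈𝐌 = ⇒∈𝐌 (element i₅ i₅≐)

    𝐌-semifield : IsSemifieldSpreadSet 𝐌
    𝐌-semifield = (𝐌-isSpreadSet , ⇒∈𝐌 origin , IM∈𝐌) ,
      λ A B A∈ B∈ → ⇒∈𝐌 (InM-+ (∈𝐌⇒ A∈) (∈𝐌⇒ B∈))

    𝐌₀-spread : IsSpreadSet₀I 𝐌₀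
    𝐌₀-spread = 𝐌₀-isSpreadSet , ⇒∈𝐌₀ (element i₂ i₂≐) , ⇒∈𝐌₀ (element i₃ i₃≐)

    abstract
      ≐-trans : ∀ {U U' U″ : Pred} → U ≐ U' → U' ≐ U″ → U ≐ U″
      ≐-trans (f , g) (f' , g') = (λ w → f' w ∘ f w) , (λ w → g w ∘ g' w)

      ≐-sym : ∀ {U U' : Pred} → U ≐ U' → U' ≐ U
      ≐-sym (f , g) = g , f

      element-T₃ : ∀ i → T₃ 𝐌 𝐌₀ (el i)
      element-T₃ i = [ at-affine , at-Π∞ ]′ (affine-or-infinite i)
        where
        at-affine : (Σ Mat λ A → Σ Mat λ B → el i ≐ RowSp A B IM) → T₃ 𝐌 𝐌₀ (el i)
        at-affine (A , B , i≐) =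
          inj₁ (A , B , ⇒∈𝐌 (proj₁ (affine⇒InM (element i i≐))) , ⇒∈𝐌 (proj₂ (affine⇒InM (element i i≐))) , i≐)
        at-Π∞ : el i ⊆ Π∞ → T₃ 𝐌 𝐌₀ (el i)
        at-Π∞ i⊆Π∞ =
          [ (λ { (C , i≐) → inj₂ (inj₁ (C , ⇒∈𝐌₀ (element i i≐) , i≐)) })
          , (λ i≐i₁ → inj₂ (inj₂ (≐-trans i≐i₁ i₁≐))) ]′ (infinite-or-i₁ i i⊆Π∞)

      T₃-element : ∀ T → T₃ 𝐌 𝐌₀ T → Σ I λ i → el i ≐ T
      T₃-element T (inj₁ (A , B , A∈ , B∈ , T≐)) = case affine⇔ (∈𝐌⇒ A∈) (∈𝐌⇒ B∈) of λ
        { (element i i≐) → i , ≐-trans i≐ (≐-sym T≐) }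
      T₃-element T (inj₂ (inj₁ (C , C∈ , T≐))) = case ∈𝐌₀⇒ C∈ of λ
        { (element i i≐) → i , ≐-trans i≐ (≐-sym T≐) }
      T₃-element T (inj₂ (inj₂ T≐)) = i₁ , ≐-trans i₁≐ (≐-sym T≐)

    -- Normal elements at infinity and the right nucleus.

    module _ {i : I} {C : Mat} (i≐ : el i ≐ RowSp IM C 0M) where

      abstract
        -- Shift (A,0,I) along (I,C,0) by -eA: the first matrix becomes 0, so t = -xA, and the
        -- second becomes -AC. Its negative lies in M.
        normal⇒·∈ : Normal i → ∀ {A} → InM A → InM (A ·M C)
        normal⇒·∈ normal {A} A∈ = finish (shift IM C e normal i≐ A∈ e≢0 (⊖ (e ⊙ A)))
          where
          vanishes : ∀ x t {b} → x ⊙ 0M ≡ (t ⊙ IM) +v (x ⊙ A) → b ≡ (t ⊙ C) +v (x ⊙ 0M) →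
            (x ⊙ (A ·M C)) +v b ≡ 0v
          vanishes x t {b} 0≡ b≡ = begin
            (x ⊙ (A ·M C)) +v b            ≡⟨ cong₂ _+v_ (⊙-·M x A C) b≡tC ⟩
            ((x ⊙ A) ⊙ C) +v (t ⊙ C)       ≡⟨ ⊕-homo (⊙ₗ C) (x ⊙ A) t ⟨
            ((x ⊙ A) +v t) ⊙ C             ≡⟨ cong (_⊙ C) xA+t≡0 ⟩
            0v ⊙ C                         ≡⟨ 𝟘-homo (⊙ₗ C) ⟩
            0v                             ∎
            where
            open ≡-Reasoning
            b≡tC : b ≡ t ⊙ C
            b≡tC = trans b≡ (trans (cong ((t ⊙ C) +v_) (⊙-0M x)) (identityʳ (t ⊙ C)))
            xA+t≡0 : (x ⊙ A) +v t ≡ 0v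
            xA+t≡0 = trans (comm (x ⊙ A) t)
              (trans (cong (_+v (x ⊙ A)) (sym (⊙-IM t))) (trans (sym 0≡) (⊙-0M x)))
          read-off : ∀ {A' B'} → A' ≡ 0M → Affine A' B' → Graph IM C A 0M A' B' → InM (A ·M C)
          read-off {B' = B'} refl 0B' graph = case InM-neg (second⇒first 0B') of λ
            { (N , N∈ , N+B'≡0) → subst InM
                (cancel {N} {A ·M C} {B'} N+B'≡0 λ x → case graph x of λ
                  { (t , 0≡ , eqB) → vanishes x t 0≡ eqB })
                N∈ }
          finish : Shift IM C A 0M e (⊖ (e ⊙ A)) → InM (A ·M C)
          finish (shifted A' B' eqA _ A'B' graph) =
            read-off (zero-first A'B' e e≢0 (trans eqA (⊖-cancel (e ⊙ A)))) A'B' graph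

        -- Shift (0,B,I) along (I,C,0) so as to annihilate the second matrix: the first becomes some
        -- A' with A'C = -B, and -A' is the preimage. The required y with yC = -eB exists because a
        -- nonzero C is nonsingular, (I,C,0) and (I,0,0) being different elements.
        normal⇒·onto : C ≢ 0M → Normal i → ∀ {B} → InM B → Σ Mat λ A → InM A × A ·M C ≡ B
        normal⇒·onto C≢0 normal {B} B∈ = choose
          (injective⇒surjective V↔Fin V↔Fin (_⊙ C) (kernel⇒injective (⊙ₗ C) C-kernel) (⊖ (e ⊙ B)))
          where
          C-kernel : TrivialKernel (⊙ₗ C)
          C-kernel x xC≡0 = decidable-stable (x ≟v 0v) λ x≢0 →
            C≢0 (infinite-unique x x≢0 (element i i≐) (element i₂ i₂≐) (trans xC≡0 (sym (⊙-0M x))))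
          agree : ∀ x t {a n} → a ≡ (t ⊙ IM) +v (x ⊙ 0M) → x ⊙ 0M ≡ (t ⊙ C) +v (x ⊙ B) → n +v a ≡ 0v →
            (n ⊙ C) ≡ x ⊙ B
          agree x t {a} {n} a≡ 0≡ n+a≡0 = ∙-cancelʳ (a ⊙ C) (n ⊙ C) (x ⊙ B) (begin
            (n ⊙ C) +v (a ⊙ C)    ≡⟨ ⊕-homo (⊙ₗ C) n a ⟨
            (n +v a) ⊙ C          ≡⟨ cong (_⊙ C) n+a≡0 ⟩
            0v ⊙ C                ≡⟨ 𝟘-homo (⊙ₗ C) ⟩
            0v                    ≡⟨ ⊙-0M x ⟨
            x ⊙ 0M                ≡⟨ 0≡ ⟩
            (t ⊙ C) +v (x ⊙ B)    ≡⟨ comm (t ⊙ C) (x ⊙ B) ⟩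
            (x ⊙ B) +v (t ⊙ C)    ≡⟨ cong (λ r → (x ⊙ B) +v (r ⊙ C)) a≡t ⟨
            (x ⊙ B) +v (a ⊙ C)    ∎)
            where
            open ≡-Reasoning
            a≡t : a ≡ t
            a≡t = trans a≡ (trans (cong₂ _+v_ (⊙-IM t) (⊙-0M x)) (identityʳ t))
          read-off : ∀ {A' B'} → B' ≡ 0M → Affine A' B' → Graph IM C 0M B A' B' →
            Σ Mat λ A → InM A × A ·M C ≡ B
          read-off {A'} refl A'∈ graph = case InM-neg A'∈ of λ
            { (N , N∈ , N+A'≡0) → N , N∈ , Mat-ext λ x → case graph x of λ
              { (t , eqA , 0≡) → trans (⊙-·M x N C) (agree x t eqA 0≡ (N+A'≡0 x)) } }
          finish : ∀ y → y ⊙ C ≡ ⊖ (e ⊙ B) → Shift IM C 0M B e y → Σ Mat λ A → InM A × A ·M C ≡ B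
          finish y yC≡ (shifted A' B' _ eqB A'B' graph) = read-off
            (zero-second A'B' e e≢0 (trans eqB (trans (cong (_+v (e ⊙ B)) yC≡) (inverseˡ (e ⊙ B)))))
            A'B' graph
          choose : (Σ V λ y → y ⊙ C ≡ ⊖ (e ⊙ B)) → Σ Mat λ A → InM A × A ·M C ≡ B
          choose (y , yC≡) = finish y yC≡ (shift IM C e normal i≐ (first⇒second B∈) e≢0 y)

        normal⇒InNr : Normal i → InNr 𝐌 C
        -- C itself is in M as the product of the member `IM` with C. Whether C is zero is decided
        -- by its value at `e`.
        normal⇒InNr normal = ⇒∈𝐌 (subst InM IM·C≡C (normal⇒·∈ normal (element i₅ i₅≐))) , stable ((e ⊙ C) ≟v 0v)
          where
          IM·C≡C : IM ·M C ≡ C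
          IM·C≡C = Mat-ext λ x → trans (⊙-·M x IM C) (cong (_⊙ C) (⊙-IM x))
          stable : Dec (e ⊙ C ≡ 0v) → C ≡ 0M ⊎ RightStable 𝐌 C
          stable (yes eC≡0) = inj₁
            (infinite-unique e e≢0 (element i i≐) (element i₂ i₂≐) (trans eC≡0 (sym (⊙-0M e))))
          stable (no eC≢0) = inj₂ ((λ A A∈ → ⇒∈𝐌 (normal⇒·∈ normal (∈𝐌⇒ A∈))) , onto)
            where
            C≢0 : C ≢ 0M
            C≢0 C≡0 = eC≢0 (trans (cong (e ⊙_) C≡0) (⊙-0M e))
            onto : ∀ B → B ∈ 𝐌 → Σ Mat λ A → A ∈ 𝐌 × A ·M C ≡ B
            onto B B∈ = case normal⇒·onto C≢0 normal (∈𝐌⇒ B∈) of λ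
              { (A , A∈ , AC≡B) → A , ⇒∈𝐌 A∈ , AC≡B }

    abstract
      InNr⇒·∈ : ∀ {C} → InNr 𝐌 C → ∀ {A} → InM A → InM (A ·M C)
      InNr⇒·∈ {C} (_ , inj₁ C≡0) {A} _ = subst InM (Mat-ext {0M} {A ·M C} 0≡AC) origin
        where
        0≡AC : ∀ x → x ⊙ 0M ≡ x ⊙ (A ·M C)
        0≡AC x = trans (⊙-0M x)
          (sym (trans (⊙-·M x A C) (trans (cong ((x ⊙ A) ⊙_) C≡0) (⊙-0M (x ⊙ A)))))
      InNr⇒·∈ (_ , inj₂ (·∈ , _)) {A} A∈ = ∈𝐌⇒ (·∈ A (⇒∈𝐌 A∈))

      Π∞-parametrization : Parametrization (V⃗ ⊗ V⃗) W⃗ Π∞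
      Π∞-parametrization = record
        { map-to   = ⟨ fst , ⟨ snd , 0ₗ ⟩ ⟩
        ; kernel   = λ x eq → cong₂ _,_ (cong proj₁ eq) (cong (proj₁ ∘ proj₂) eq)
        ; sound    = λ _ → refl
        ; complete = λ (u , v , z) z≡0 → (u , v) , cong (λ t → u , v , t) (sym z≡0)
        }

      -- Distinct elements meet only in 0, so their sum has q^n · q^n vectors, as many as `Π∞`.
      join-within-Π∞ : ∀ i j → ¬ (el i ≐ el j) → el i ⊆ Π∞ → el j ⊆ Π∞ → Π∞ ⊆ Join (el i) (el j)
      join-within-Π∞ i j i≢j i⊆Π∞ j⊆Π∞ w w∈Π∞ = finish
        (sum-fills (param i) (param j) disjoint Π∞-parametrization V×V↔Fin V×V↔Fin i⊆Π∞ j⊆Π∞ w w∈Π∞)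
        where
        module Pᵢ = Parametrization (param i)
        module Pⱼ = Parametrization (param j)
        disjoint : ∀ y → el i y → el j y → y ≡ 0W
        disjoint y iy jy = decidable-stable (finite-≟ W↔Fin y 0W) λ y≢0 → i≢j (meet i j y y≢0 iy jy)
        finish : (Σ (V × V) λ x → ([ Pᵢ.map-to , Pⱼ.map-to ] ⟨$⟩ x) ≡ w) → Join (el i) (el j) w
        finish ((a , b) , eq) = (Pᵢ.map-to ⟨$⟩ a) , (Pⱼ.map-to ⟨$⟩ b) , Pᵢ.sound a , Pⱼ.sound b , sym eq

      ⊆-join : ∀ i j → el i ⊆ Join (el i) (el j)
      ⊆-join i j w iw = w , 0W , iw , closed-𝟘 (param j) , sym (VectorSpace.identityʳ W⃗ w)

    -- (A', B + (A' − A)C, I) is the element through z A' in the join of (I,C,0) and (A,B,I).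
    record Sheared (C A B A' : Mat) : Set₁ where
      constructor sheared
      field
        D       : Mat
        affine' : Affine A' ((D ·M C) +M B)
        D-spec  : A' − A ≈ D

    abstract
      -- D = A' - A is in M by additivity, DC by the nucleus condition, and DC + B by additivity
      -- again.
      shear : ∀ {C A B A'} → InNr 𝐌 C → Affine A B → InM A' → Sheared C A B A'
      shear {C} {A} {B} {A'} C∈Nr AB A'∈ = finish (affine⇒InM AB)
        where
        finish : InM A × InM B → Sheared C A B A'
        finish (A∈ , B∈) = case InM-neg A∈ of λ
          { (N , N∈ , N+A≡0) → sheared (A' +M N)
              (affine⇔ A'∈ (InM-+ (InNr⇒·∈ C∈Nr (InM-+ A'∈ N∈)) B∈))
              (λ x → spec x N (N+A≡0 x)) }
          where
          spec : ∀ x N → (x ⊙ N) +v (x ⊙ A) ≡ 0v → (x ⊙ (A' +M N)) +v (x ⊙ A) ≡ x ⊙ A'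
          spec x N N+A≡0 = begin
            (x ⊙ (A' +M N)) +v (x ⊙ A)          ≡⟨ cong (_+v (x ⊙ A)) (⊙-+M x A' N) ⟩
            ((x ⊙ A') +v (x ⊙ N)) +v (x ⊙ A)    ≡⟨ assoc (x ⊙ A') (x ⊙ N) (x ⊙ A) ⟩
            (x ⊙ A') +v ((x ⊙ N) +v (x ⊙ A))    ≡⟨ cong ((x ⊙ A') +v_) N+A≡0 ⟩
            (x ⊙ A') +v 0v                      ≡⟨ identityʳ (x ⊙ A') ⟩
            x ⊙ A'                              ∎
            where open ≡-Reasoning

      shear-point : ∀ {C A B A' D} → A' − A ≈ D → ∀ x →
        (rowₗ IM C 0M ⟨$⟩ (x ⊙ D)) +W (rowₗ A B IM ⟨$⟩ x) ≡ (x ⊙ A' , x ⊙ ((D ·M C) +M B) , x)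
      shear-point {C} {A} {B} {A'} {D} D-spec x = cong₂ _,_
        (trans (cong (_+v (x ⊙ A)) (⊙-IM (x ⊙ D))) (D-spec x))
        (cong₂ _,_
          (trans (cong (_+v (x ⊙ B)) (sym (⊙-·M x D C))) (sym (⊙-+M x (D ·M C) B)))
          (trans (0M-+ (x ⊙ D) (x ⊙ IM)) (⊙-IM x)))

      affine-join : ∀ {i j C A B} → el i ≐ RowSp IM C 0M → el j ≐ RowSp A B IM → InNr 𝐌 C →
        ∀ t z → z ≢ 0v → Σ I λ k → el k ⊆ Join (el i) (el j) ×
          el k ((rowₗ IM C 0M ⟨$⟩ t) +W (rowₗ A B IM ⟨$⟩ z))
      -- Only A' with zA' = t + zA is wanted. The second coordinate 0 of the point is a mere
      -- default, since the second matrix is rebuilt as (A' - A)C + B.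
      affine-join {i} {j} {C} {A} {B} i≐ j≐ C∈Nr t z z≢0 = start (affine-through (t +v (z ⊙ A)) 0v z z≢0)
        where
        Target : Set₁
        Target = Σ I λ k → el k ⊆ Join (el i) (el j) × el k ((rowₗ IM C 0M ⟨$⟩ t) +W (rowₗ A B IM ⟨$⟩ z))
        finish : ∀ {A'} → z ⊙ A' ≡ t +v (z ⊙ A) → Sheared C A B A' → Target
        finish {A'} zA'≡ (sheared D (element k k≐) D-spec) = k , k⊆join , kw
          where
          k∋ : ∀ x → el k ((rowₗ IM C 0M ⟨$⟩ (x ⊙ D)) +W (rowₗ A B IM ⟨$⟩ x))
          k∋ x = subst (el k) (sym (shear-point {C} {A} {B} {A'} {D} D-spec x))
            (proj₂ k≐ _ (affine-point A' ((D ·M C) +M B) x))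
          t≡zD : t ≡ z ⊙ D
          t≡zD = ∙-cancelʳ (z ⊙ A) t (z ⊙ D) (trans (sym zA'≡) (sym (D-spec z)))
          kw : el k ((rowₗ IM C 0M ⟨$⟩ t) +W (rowₗ A B IM ⟨$⟩ z))
          kw = subst (λ s → el k ((rowₗ IM C 0M ⟨$⟩ s) +W (rowₗ A B IM ⟨$⟩ z))) (sym t≡zD) (k∋ z)
          k⊆join : el k ⊆ Join (el i) (el j)
          k⊆join w kw = decompose (proj₁ k≐ w kw)
            where
            decompose : RowSp A' ((D ·M C) +M B) IM w → Join (el i) (el j) w
            decompose (x , w≡) = (rowₗ IM C 0M ⟨$⟩ (x ⊙ D)) , (rowₗ A B IM ⟨$⟩ x) ,
              proj₂ i≐ _ (x ⊙ D , refl) , proj₂ j≐ _ (x , refl) ,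
              trans w≡ (trans (cong (λ s → x ⊙ A' , x ⊙ ((D ·M C) +M B) , s) (⊙-IM x))
                              (sym (shear-point {C} {A} {B} {A'} {D} D-spec x)))
        start : (Σ Mat λ A' → Σ Mat λ B' → Affine A' B' × z ⊙ A' ≡ t +v (z ⊙ A) × z ⊙ B' ≡ 0v) → Target
        start (A' , B' , A'B' , zA'≡ , _) =
          finish zA'≡ (shear C∈Nr (element j j≐) (proj₁ (affine⇒InM A'B')))

      -- If `j` lies at infinity, the join is all of `Π∞`, which contains the element through each
      -- of its points. If `j` is (A,B,I), the sheared elements cover the points of the join off
      -- `Π∞`.
      InNr⇒normal : ∀ {i C} → el i ≐ RowSp IM C 0M → InNr 𝐌 C → Normal i
      InNr⇒normal {i} {C} i≐ C∈Nr j i≢j w w≢0 (p , r , ip , jr , w≡) =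
        [ affine-case , infinite-case ]′ (affine-or-infinite j)
        where
        Target : Set₁
        Target = Σ I λ k → el k ⊆ Join (el i) (el j) × el k w
        infinite-case : el j ⊆ Π∞ → Target
        infinite-case j⊆Π∞ = through (cover w w≢0)
          where
          i⊆Π∞ : el i ⊆ Π∞
          i⊆Π∞ w' iw' = proj₂ (infinite-coords C w' (proj₁ i≐ w' iw'))
          w∈Π∞ : Π∞ w
          w∈Π∞ = trans (cong (proj₂ ∘ proj₂) w≡)
            (trans (cong₂ _+v_ (i⊆Π∞ p ip) (j⊆Π∞ r jr)) (identityˡ 0v))
          through : (Σ I λ k → el k w) → Target
          through (k , kw) =
            k , (λ w' kw' → join-within-Π∞ i j i≢j i⊆Π∞ j⊆Π∞ w' (at-infinity k w w≢0 w∈Π∞ kw w' kw')) , kw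
        affine-case : (Σ Mat λ A → Σ Mat λ B → el j ≐ RowSp A B IM) → Target
        affine-case (A , B , j≐) = split (proj₁ i≐ p ip) (proj₁ j≐ r jr)
          where
          split : RowSp IM C 0M p → RowSp A B IM r → Target
          split (t , p≡) (z , r≡) = by-height (z ≟v 0v)
            where
            by-height : Dec (z ≡ 0v) → Target
            -- At height 0 the summand from (A,B,I) vanishes, so the point is on (I,C,0) itself.
            by-height (yes z≡0) = i , ⊆-join i j , subst (el i) (sym w≡p) ip
              where
              w≡p : w ≡ p
              w≡p = trans w≡ (trans
                (cong (p +W_) (trans r≡ (trans (cong (rowₗ A B IM ⟨$⟩_) z≡0) (𝟘-homo (rowₗ A B IM)))))
                (VectorSpace.identityʳ W⃗ p))
            by-height (no z≢0) = case affine-join {i} {j} {C} {A} {B} i≐ j≐ C∈Nr t z z≢0 of λ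
              { (k , k⊆ , kw) → k , k⊆ , subst (el k) (sym (trans w≡ (cong₂ _+W_ p≡ r≡))) kw }

      normal-target : ∀ i → Normal i → el i ⊆ Π∞ → NormalTarget 𝐌 𝐌₀ (el i)
      normal-target i normal i⊆Π∞ = [ at-infinite , at-i₁ ]′ (infinite-or-i₁ i i⊆Π∞)
        where
        at-infinite : (Σ Mat λ C → el i ≐ RowSp IM C 0M) → NormalTarget 𝐌 𝐌₀ (el i)
        at-infinite (C , i≐) = inj₁ (C , ⇒∈𝐌₀ (element i i≐) , normal⇒InNr {i} {C} i≐ normal , i≐)
        at-i₁ : el i ≐ el i₁ → NormalTarget 𝐌 𝐌₀ (el i)
        at-i₁ i≐i₁ = inj₂ (≐-trans {el i} {el i₁} {RowSp 0M IM 0M} i≐i₁ i₁≐)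

      target-normal : ∀ T → NormalTarget 𝐌 𝐌₀ T → Σ I λ i → Normal i × el i ⊆ Π∞ × el i ≐ T
      target-normal T (inj₁ (C , C∈ , C∈Nr , T≐)) = case ∈𝐌₀⇒ C∈ of λ
        { (element i i≐) → i , InNr⇒normal i≐ C∈Nr ,
            (λ w iw → proj₂ (infinite-coords C w (proj₁ i≐ w iw))) , ≐-trans i≐ (≐-sym T≐) }
      target-normal T (inj₂ T≐) =
        i₁ , normal₁ , (λ w i₁w → proj₂ (i₁-coords w i₁w)) , ≐-trans i₁≐ (≐-sym T≐)

-- Collineations induced by invertible linear maps.

module Collineations {q : ℕ} (𝔽 : FiniteField q) (n : ℕ) where
  open FiniteField 𝔽
  open Geometry 𝔽 n
  open LinearAlgebra 𝔽
  open Matrices 𝔽 n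

  ∼-refl : ∀ {w w'} → w ≡ w' → w ∼ w'
  ∼-refl {w} refl = 1# , 0≢1 ∘ sym , sym (VectorSpace.·-identity W⃗ w)

  module _ (φ Φ : W⃗ ⊸ W⃗) (φΦ : ∀ w → (φ ⟨$⟩ Φ ⟨$⟩ w) ≡ w) (Φφ : ∀ w → (Φ ⟨$⟩ φ ⟨$⟩ w) ≡ w) where
    abstract
      φ-kernel : TrivialKernel φ
      φ-kernel w eq = trans (sym (Φφ w)) (trans (cong (Φ ⟨$⟩_) eq) (𝟘-homo Φ))

      Φ-nonzero : ∀ w → NonZeroW w → NonZeroW (Φ ⟨$⟩ w)
      Φ-nonzero w w≢0 eq = w≢0 (trans (sym (φΦ w)) (trans (cong (φ ⟨$⟩_) eq) (𝟘-homo φ)))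

      linear-collineation : IsCollineation (φ ⟨$⟩_)
      linear-collineation = record
        { nonzero    = λ w w≢0 eq → w≢0 (φ-kernel w eq)
        ; wellDef    = λ w w' _ (a , a≢0 , eq) → a , a≢0 , trans (cong (φ ⟨$⟩_) eq) (·-homo φ a w)
        ; injective  = λ w w' _ _ (a , a≢0 , eq) →
            a , a≢0 , kernel⇒injective φ φ-kernel (trans eq (sym (·-homo φ a w)))
        ; surjective = λ t t≢0 → (Φ ⟨$⟩ t) , Φ-nonzero t t≢0 , ∼-refl (φΦ t)
        ; collinear  = λ a b c _ _ _ →
            (λ (k , k≢0 , eq) → k , k≢0 ,
              trans (sym (combination-homo φ k (a ∷ b ∷ c ∷ []))) (trans (cong (φ ⟨$⟩_) eq) (𝟘-homo φ))) ,
            (λ (k , k≢0 , eq) → k , k≢0 ,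
              φ-kernel _ (trans (combination-homo φ k (a ∷ b ∷ c ∷ [])) eq))
        }

      imageEq : ∀ E T → (λ w → E (Φ ⟨$⟩ w)) ≐ T → ImageEq (φ ⟨$⟩_) E T
      imageEq E T (to , from) =
        (λ w _ Ew → to (φ ⟨$⟩ w) (subst E (sym (Φφ w)) Ew)) ,
        (λ t t≢0 Tt → (Φ ⟨$⟩ t) , Φ-nonzero t t≢0 , from t Tt , ∼-refl (φΦ t))

-- Choice of a frame and transport of the spread.

module Frame {q : ℕ} (𝔽 : FiniteField q) (n : ℕ)
  (e : Geometry.V 𝔽 n) (e≢0 : e ≢ Geometry.0v 𝔽 n)
  (𝒮 : Geometry.Family 𝔽 n) (spread : Geometry.IsSpread 𝔽 n 𝒮)
  (Π₀ : Geometry.Pred 𝔽 n) (Π₀-subspace : Geometry.IsSubspace 𝔽 n (n ℕ.+ n) Π₀)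
  (E₁ E₂ E₃ : Geometry.Pred 𝔽 n)
  (normal₁ : Geometry.IsNormal 𝔽 n 𝒮 E₁) (normal₂ : Geometry.IsNormal 𝔽 n 𝒮 E₂)
  (normal₃ : Geometry.IsNormal 𝔽 n 𝒮 E₃)
  (E₁≢E₂ : ¬ Geometry._≐_ 𝔽 n E₁ E₂) (E₁≢E₃ : ¬ Geometry._≐_ 𝔽 n E₁ E₃)
  (E₂≢E₃ : ¬ Geometry._≐_ 𝔽 n E₂ E₃)
  (E₁⊆Π₀ : Geometry._⊆_ 𝔽 n E₁ Π₀) (E₂⊆Π₀ : Geometry._⊆_ 𝔽 n E₂ Π₀)
  (E₃⊆Π₀ : Geometry._⊆_ 𝔽 n E₃ Π₀)
  where
  open FiniteField 𝔽
  open Geometry 𝔽 n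
  open LinearAlgebra 𝔽
  open Matrices 𝔽 n
  open VectorSpace W⃗ hiding (Carrier)

  parametrization : ∀ {d U} → IsSubspace d U → Parametrization (𝔽^ d) W⃗ U
  parametrization (b , independent , spans) = record
    { map-to   = combinationₗ W⃗ b
    ; kernel   = independent
    ; sound    = λ c → proj₂ (spans _) (c , refl)
    ; complete = λ w → proj₁ (spans w)
    }

  P : ∀ {E} → 𝒮 E → Parametrization V⃗ W⃗ E
  P {E} E∈ = parametrization (proj₁ spread E E∈)

  ∈₁ : 𝒮 E₁
  ∈₁ = proj₁ normal₁
  ∈₂ : 𝒮 E₂
  ∈₂ = proj₁ normal₂
  ∈₃ : 𝒮 E₃
  ∈₃ = proj₁ normal₃

  Q₀ : Parametrization (𝔽^ (n ℕ.+ n)) W⃗ Π₀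
  Q₀ = parametrization Π₀-subspace

  abstract
    disjoint : ∀ {E E'} → 𝒮 E → 𝒮 E' → ¬ (E ≐ E') → ∀ y → E y → E' y → y ≡ 0W
    disjoint {E} {E'} E∈ E'∈ E≢E' y Ey E'y = decidable-stable (finite-≟ W↔Fin y 0W)
      λ y≢0 → E≢E' (proj₂ (proj₂ spread) E E' y E∈ E'∈ y≢0 Ey E'y)

    V²↔ : Vec F (n ℕ.+ n) ↔ Fin (q ^ n ℕ.* q ^ n)
    V²↔ = subst (λ N → Vec F (n ℕ.+ n) ↔ Fin N) (ℕ.^-distribˡ-+-* q n n) (Vec↔Fin (n ℕ.+ n))

    Π₀⊆join : Π₀ ⊆ Join E₁ E₂
    Π₀⊆join w w∈Π₀ = finish (sum-fills (P ∈₁) (P ∈₂) (disjoint ∈₁ ∈₂ E₁≢E₂) Q₀ V×V↔Fin V²↔ E₁⊆Π₀ E₂⊆Π₀ w w∈Π₀)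
      where
      module P₁ = Parametrization (P ∈₁)
      module P₂ = Parametrization (P ∈₂)
      finish : (Σ (V × V) λ x → ([ P₁.map-to , P₂.map-to ] ⟨$⟩ x) ≡ w) → Join E₁ E₂ w
      finish ((a , b) , eq) = (P₁.map-to ⟨$⟩ a) , (P₂.map-to ⟨$⟩ b) , P₁.sound a , P₂.sound b , sym eq

    -- `Π₀` is the join of `E₁` and `E₂`, hence partitioned. This is needed before coordinates
    -- exist, so that an element through a vector outside `Π₀` is disjoint from `Π₀` and can serve
    -- as (0,0,I).
    meets-Π₀⇒⊆ : ∀ {E} → 𝒮 E → ∀ w → NonZeroW w → E w → Π₀ w → E ⊆ Π₀
    meets-Π₀⇒⊆ {E} E∈ w w≢0 Ew w∈Π₀ w' Ew' =
      finish (proj₂ normal₁ E₂ ∈₂ E₁≢E₂ w w≢0 (Π₀⊆join w w∈Π₀))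
      where
      join⊆Π₀ : Join E₁ E₂ ⊆ Π₀
      join⊆Π₀ _ (a , b , E₁a , E₂b , refl) = closed-⊕ Q₀ (E₁⊆Π₀ a E₁a) (E₂⊆Π₀ b E₂b)
      finish : (Σ Pred λ G → 𝒮 G × G ⊆ Join E₁ E₂ × G w) → Π₀ w'
      finish (G , G∈ , G⊆ , Gw) =
        join⊆Π₀ w' (G⊆ w' (proj₁ (proj₂ (proj₂ spread) E G w E∈ G∈ w≢0 Ew Gw) w' Ew'))

  record Outside : Set₁ where
    field
      E₄      : Pred
      ∈₄      : 𝒮 E₄
      E₄∩Π₀   : ∀ w → E₄ w → Π₀ w → w ≡ 0W

  abstract
    outside : Outside
    outside = finish (∃-outside Q₀ V²↔ W↔Fin size)
      where
      size : q ^ n ℕ.* q ^ n ℕ.< q ^ n ℕ.* (q ^ n ℕ.* q ^ n)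
      size = 1<N⇒N²<N³ (distinct⇒1<size V↔Fin e≢0)
      finish : (Σ W λ w → ¬ Π₀ w) → Outside
      finish (w , w∉Π₀) = through (proj₁ (proj₂ spread) w w≢0)
        where
        w≢0 : NonZeroW w
        w≢0 w≡0 = w∉Π₀ (subst Π₀ (sym w≡0) (closed-𝟘 Q₀))
        through : (Σ Pred λ E → 𝒮 E × E w) → Outside
        through (E , E∈ , Ew) = record
          { E₄ = E ; ∈₄ = E∈
          ; E₄∩Π₀ = λ y Ey y∈Π₀ → decidable-stable (finite-≟ W↔Fin y 0W)
              λ y≢0 → w∉Π₀ (meets-Π₀⇒⊆ E∈ y y≢0 Ey y∈Π₀ w Ew)
          }

  open Outside outside public

  L₂ : V⃗ ⊸ W⃗
  L₂ = Parametrization.map-to (P ∈₂)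

  -- A parametrisation of `E₁` matched to that of `E₂` so that `E₃` becomes (I,I,0).
  record Diagonal₁ : Set where
    field
      g₁        : V⃗ ⊸ W⃗
      g₁-kernel : TrivialKernel g₁
      g₁∈E₁     : ∀ x → E₁ (g₁ ⟨$⟩ x)
      L₂+g₁∈E₃  : ∀ x → E₃ ((L₂ ⟨$⟩ x) +W (g₁ ⟨$⟩ x))

  -- A parametrisation of `E₄` matched to that of `E₂` so that a further element `E₅` becomes
  -- (I,0,I); this is what puts `IM` into M.
  record Diagonal₄ : Set₁ where
    field
      E₅        : Pred
      ∈₅        : 𝒮 E₅
      g₄        : V⃗ ⊸ W⃗
      g₄-kernel : TrivialKernel g₄
      g₄∈E₄     : ∀ x → E₄ (g₄ ⟨$⟩ x)
      L₂+g₄∈E₅  : ∀ x → E₅ ((L₂ ⟨$⟩ x) +W (g₄ ⟨$⟩ x))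

  abstract
    diagonal₁ : Diagonal₁
    diagonal₁ = finish (graph-over (P ∈₂) (P ∈₁) (P ∈₃) Q₀ V×V↔Fin V²↔ E₂⊆Π₀ E₁⊆Π₀ E₃⊆Π₀
        (disjoint ∈₁ ∈₃ E₁≢E₃) (disjoint ∈₂ ∈₃ E₂≢E₃))
      where
      finish : (Σ (V⃗ ⊸ W⃗) λ g → TrivialKernel g × (∀ x → E₁ (g ⟨$⟩ x)) ×
        (∀ x → E₃ ((L₂ ⟨$⟩ x) +W (g ⟨$⟩ x)))) → Diagonal₁
      finish (g , ker , g∈ , sum∈) =
        record { g₁ = g ; g₁-kernel = ker ; g₁∈E₁ = g∈ ; L₂+g₁∈E₃ = sum∈ }

    E₂∩E₄ : ∀ y → E₂ y → E₄ y → y ≡ 0W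
    E₂∩E₄ y E₂y E₄y = E₄∩Π₀ y E₄y (E₂⊆Π₀ y E₂y)

    nonzero-at-e : ∀ {E} (E∈ : 𝒮 E) → NonZeroW (Parametrization.map-to (P E∈) ⟨$⟩ e)
    nonzero-at-e E∈ eq = e≢0 (Parametrization.kernel (P E∈) e eq)

    E₂≢E₄ : ¬ (E₂ ≐ E₄)
    E₂≢E₄ (E₂⊆E₄ , _) = nonzero-at-e ∈₂ (E₂∩E₄ _ E₂L₂e (E₂⊆E₄ _ E₂L₂e))
      where
      E₂L₂e : E₂ (L₂ ⟨$⟩ e)
      E₂L₂e = Parametrization.sound (P ∈₂) e

    -- Normality of `E₂` gives an element inside the join of `E₂` and `E₄` through a vector whose
    -- components in both are nonzero. It therefore differs from both and is a graph over `E₂`.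
    diagonal₄ : Diagonal₄
    diagonal₄ = finish (proj₂ normal₂ E₄ ∈₄ E₂≢E₄ w w≢0 (a , b , E₂a , E₄b , refl))
      where
      module P₄ = Parametrization (P ∈₄)
      a b w : W
      a = L₂ ⟨$⟩ e
      b = P₄.map-to ⟨$⟩ e
      w = a +W b
      E₂a : E₂ a
      E₂a = Parametrization.sound (P ∈₂) e
      E₄b : E₄ b
      E₄b = P₄.sound e
      w≢0 : NonZeroW w
      w≢0 eq = e≢0 (cong proj₁ (sum-kernel (P ∈₂) (P ∈₄) E₂∩E₄ (e , e) eq))
      J-param : Parametrization (V⃗ ⊗ V⃗) W⃗ (Join E₂ E₄)
      J-param = record
        { map-to   = [ L₂ , P₄.map-to ]
        ; kernel   = sum-kernel (P ∈₂) (P ∈₄) E₂∩E₄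
        ; sound    = λ (x , y) → _ , _ , Parametrization.sound (P ∈₂) x , P₄.sound y , refl
        ; complete = λ y (u , v , E₂u , E₄v , eq) →
            let x₂ , eq₂ = Parametrization.complete (P ∈₂) u E₂u
                x₄ , eq₄ = P₄.complete v E₄v
            in (x₂ , x₄) , trans (cong₂ _+W_ eq₂ eq₄) (sym eq)
        }
      E₂⊆J : E₂ ⊆ Join E₂ E₄
      E₂⊆J u E₂u = u , 0W , E₂u , closed-𝟘 (P ∈₄) , sym (identityʳ u)
      E₄⊆J : E₄ ⊆ Join E₂ E₄
      E₄⊆J u E₄u = 0W , u , closed-𝟘 (P ∈₂) , E₄u , sym (identityˡ u)
      finish : (Σ Pred λ G → 𝒮 G × G ⊆ Join E₂ E₄ × G w) → Diagonal₄
      finish (G , G∈ , G⊆J , Gw) = assemble (graph-over (P ∈₂) (P ∈₄) (P G∈) J-param V×V↔Fin V×V↔Fin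
          E₂⊆J E₄⊆J G⊆J (disjoint ∈₄ G∈ E₄≢G) (disjoint ∈₂ G∈ E₂≢G))
        where
        E₄≢G : ¬ (E₄ ≐ G)
        E₄≢G (_ , G⊆E₄) = nonzero-at-e ∈₂ (E₂∩E₄ a E₂a (closed-cancelʳ (P ∈₄) E₄b (G⊆E₄ w Gw)))
        E₂≢G : ¬ (E₂ ≐ G)
        E₂≢G (_ , G⊆E₂) = nonzero-at-e ∈₄ (E₂∩E₄ b (closed-cancelˡ (P ∈₂) E₂a (G⊆E₂ w Gw)) E₄b)
        assemble : (Σ (V⃗ ⊸ W⃗) λ g → TrivialKernel g × (∀ x → E₄ (g ⟨$⟩ x)) ×
          (∀ x → G ((L₂ ⟨$⟩ x) +W (g ⟨$⟩ x)))) → Diagonal₄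
        assemble (g , ker , g∈ , sum∈) = record
          { E₅ = G ; ∈₅ = G∈ ; g₄ = g ; g₄-kernel = ker ; g₄∈E₄ = g∈ ; L₂+g₄∈E₅ = sum∈ }

  open Diagonal₁ diagonal₁ public
  open Diagonal₄ diagonal₄ public

  -- (x,y,z) ↦ L₂ x + g₁ y + g₄ z sends (I,0,0), (0,I,0), (I,I,0), (0,0,I), (I,0,I) to E₂, E₁, E₃, E₄, E₅.
  Φ : W⃗ ⊸ W⃗
  Φ = [ L₂ , [ g₁ , g₄ ] ]

  abstract
    -- `E₁` and `E₂` lie in `Π₀` while `E₄` meets it only in 0, so the `E₄` component of a vanishing
    -- sum is 0; what remains lies in the trivial intersection of `E₁` and `E₂`.
    Φ-kernel : TrivialKernel Φ
    Φ-kernel = copair-kernel L₂ [ g₁ , g₄ ] (Parametrization.kernel (P ∈₂))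
      (copair-kernel g₁ g₄ g₁-kernel g₄-kernel
        λ y z eq → trans eq (E₄∩Π₀ _ (g₄∈E₄ z) (subst Π₀ eq (E₁⊆Π₀ _ (g₁∈E₁ y)))))
      λ x (y , z) eq → in-E₂ x y z eq (E₄∩Π₀ _ (g₄∈E₄ z) (closed-cancelˡ Q₀ (E₁⊆Π₀ _ (g₁∈E₁ y))
        (subst Π₀ eq (E₂⊆Π₀ _ (Parametrization.sound (P ∈₂) x)))))
      where
      in-E₂ : ∀ x y z → (L₂ ⟨$⟩ x) ≡ (g₁ ⟨$⟩ y) +W (g₄ ⟨$⟩ z) → (g₄ ⟨$⟩ z) ≡ 0W → (L₂ ⟨$⟩ x) ≡ 0W
      in-E₂ x y z eq g₄z≡0 = disjoint ∈₁ ∈₂ E₁≢E₂ _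
        (subst E₁ (sym (trans eq (trans (cong ((g₁ ⟨$⟩ y) +W_) g₄z≡0) (identityʳ _)))) (g₁∈E₁ y))
        (Parametrization.sound (P ∈₂) x)

    Φ-inverse : Σ (W⃗ ⊸ W⃗) λ φ → ∀ w → (Φ ⟨$⟩ φ ⟨$⟩ w) ≡ w
    Φ-inverse = right-inverse W↔Fin W↔Fin Φ Φ-kernel

  φ : W⃗ ⊸ W⃗
  φ = proj₁ Φ-inverse

  abstract
    Φφ : ∀ w → (Φ ⟨$⟩ φ ⟨$⟩ w) ≡ w
    Φφ = proj₂ Φ-inverse

    φΦ : ∀ w → (φ ⟨$⟩ Φ ⟨$⟩ w) ≡ w
    φΦ w = kernel⇒injective Φ Φ-kernel (Φφ (Φ ⟨$⟩ w))

    Φ-xy0 : ∀ x y → (Φ ⟨$⟩ (x , y , 0v)) ≡ (L₂ ⟨$⟩ x) +W (g₁ ⟨$⟩ y)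
    Φ-xy0 x y = cong ((L₂ ⟨$⟩ x) +W_) (trans (cong ((g₁ ⟨$⟩ y) +W_) (𝟘-homo g₄)) (identityʳ (g₁ ⟨$⟩ y)))

    Φ-x0z : ∀ x z → (Φ ⟨$⟩ (x , 0v , z)) ≡ (L₂ ⟨$⟩ x) +W (g₄ ⟨$⟩ z)
    Φ-x0z x z = cong ((L₂ ⟨$⟩ x) +W_) (trans (cong (_+W (g₄ ⟨$⟩ z)) (𝟘-homo g₁)) (identityˡ (g₄ ⟨$⟩ z)))

    Φ-0y0 : ∀ y → (Φ ⟨$⟩ (0v , y , 0v)) ≡ (g₁ ⟨$⟩ y)
    Φ-0y0 y = trans (Φ-xy0 0v y) (trans (cong (_+W (g₁ ⟨$⟩ y)) (𝟘-homo L₂)) (identityˡ (g₁ ⟨$⟩ y)))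

    Φ-00z : ∀ z → (Φ ⟨$⟩ (0v , 0v , z)) ≡ (g₄ ⟨$⟩ z)
    Φ-00z z = trans (Φ-x0z 0v z) (trans (cong (_+W (g₄ ⟨$⟩ z)) (𝟘-homo L₂)) (identityˡ (g₄ ⟨$⟩ z)))

    Φ-x00 : ∀ x → (Φ ⟨$⟩ (x , 0v , 0v)) ≡ (L₂ ⟨$⟩ x)
    Φ-x00 x = trans (Φ-xy0 x 0v) (trans (cong ((L₂ ⟨$⟩ x) +W_) (𝟘-homo g₁)) (identityʳ (L₂ ⟨$⟩ x)))

    -- The terms from `L₂` and `g₁` lie in `Π₀`, so the sum lies in `Π₀` exactly when the `E₄`
    -- component g₄ z does, that is, when z = 0.
    Π₀∘Φ≐Π∞ : (λ w → Π₀ (Φ ⟨$⟩ w)) ≐ Π∞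
    Π₀∘Φ≐Π∞ = to , from
      where
      flat : ∀ x y → Π₀ ((L₂ ⟨$⟩ x) +W (g₁ ⟨$⟩ y))
      flat x y = closed-⊕ Q₀ (E₂⊆Π₀ _ (Parametrization.sound (P ∈₂) x)) (E₁⊆Π₀ _ (g₁∈E₁ y))
      to : (λ w → Π₀ (Φ ⟨$⟩ w)) ⊆ Π∞
      to (x , y , z) Π₀Φw = g₄-kernel z (E₄∩Π₀ _ (g₄∈E₄ z)
        (closed-cancelˡ Q₀ (flat x y) (subst Π₀ (sym (assoc (L₂ ⟨$⟩ x) (g₁ ⟨$⟩ y) (g₄ ⟨$⟩ z))) Π₀Φw)))
      from : Π∞ ⊆ (λ w → Π₀ (Φ ⟨$⟩ w))
      from (x , y , z) z≡0 = subst Π₀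
        (sym (trans (cong (λ s → Φ ⟨$⟩ (x , y , s)) z≡0) (Φ-xy0 x y))) (flat x y)

  I : Set₁
  I = Σ Pred 𝒮

  el : I → Pred
  el (E , _) w = E (Φ ⟨$⟩ w)

  param : ∀ i → Parametrization V⃗ W⃗ (el i)
  param (E , E∈) = pullback (P E∈) φ Φ φΦ Φφ

  open Collineations 𝔽 n

  abstract
    cover : ∀ w → NonZeroW w → Σ I λ i → el i w
    cover w w≢0 = case proj₁ (proj₂ spread) (Φ ⟨$⟩ w) (Φ-nonzero φ Φ φΦ Φφ w w≢0) of λ
      { (E , E∈ , Ew) → (E , E∈) , Ew }

    meet : ∀ i j w → NonZeroW w → el i w → el j w → el i ≐ el j
    meet (E , E∈) (E' , E'∈) w w≢0 Ew E'w =
      case proj₂ (proj₂ spread) E E' (Φ ⟨$⟩ w) E∈ E'∈ (Φ-nonzero φ Φ φΦ Φφ w w≢0) Ew E'w of λ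
        { (f , g) → (λ _ → f _) , (λ _ → g _) }

  open Coordinatised 𝔽 n e e≢0 I el param cover meet using (Normal; module Framed)

  abstract
    ∘Φ-⊆ : ∀ {U U' : Pred} → (∀ w → U (Φ ⟨$⟩ w) → U' (Φ ⟨$⟩ w)) → U ⊆ U'
    ∘Φ-⊆ {U} {U'} f w Uw = subst U' (Φφ w) (f (φ ⟨$⟩ w) (subst U (sym (Φφ w)) Uw))

    join-∘Φ : ∀ (U U' : Pred) w → Join (λ w → U (Φ ⟨$⟩ w)) (λ w → U' (Φ ⟨$⟩ w)) w → Join U U' (Φ ⟨$⟩ w)
    join-∘Φ U U' w (u , v , Uu , U'v , eq) =
      (Φ ⟨$⟩ u) , (Φ ⟨$⟩ v) , Uu , U'v , trans (cong (Φ ⟨$⟩_) eq) (⊕-homo Φ u v)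

    ∘Φ-join : ∀ (U U' : Pred) w → Join U U' (Φ ⟨$⟩ w) → Join (λ w → U (Φ ⟨$⟩ w)) (λ w → U' (Φ ⟨$⟩ w)) w
    ∘Φ-join U U' w (u , v , Uu , U'v , eq) =
      (φ ⟨$⟩ u) , (φ ⟨$⟩ v) , subst U (sym (Φφ u)) Uu , subst U' (sym (Φφ v)) U'v ,
      trans (sym (φΦ w)) (trans (cong (φ ⟨$⟩_) eq) (⊕-homo φ u v))

    normal⇒ : ∀ {E} (normal : IsNormal 𝒮 E) → Normal (E , proj₁ normal)
    normal⇒ {E} (E∈ , partition) (E' , E'∈) E≢E' w w≢0 w∈join =
      finish (partition E' E'∈ (λ (f , g) → E≢E' ((λ _ → f _) , (λ _ → g _))) (Φ ⟨$⟩ w)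
        (Φ-nonzero φ Φ φΦ Φφ w w≢0) (join-∘Φ E E' w w∈join))
      where
      finish : (Σ Pred λ G → 𝒮 G × G ⊆ Join E E' × G (Φ ⟨$⟩ w)) →
        Σ I λ k → el k ⊆ Join (el (E , E∈)) (el (E' , E'∈)) × el k w
      finish (G , G∈ , G⊆ , Gw) = (G , G∈) , (λ w' Gw' → ∘Φ-join E E' w' (G⊆ _ Gw')) , Gw

    ⇒normal : ∀ i → Normal i → IsNormal 𝒮 (proj₁ i)
    ⇒normal (E , E∈) normal = E∈ , λ E' E'∈ E≢E' w w≢0 w∈join →
      finish E' E'∈ w (normal (E' , E'∈) (λ (f , g) → E≢E' (∘Φ-⊆ {E} {E'} f , ∘Φ-⊆ {E'} {E} g)) (φ ⟨$⟩ w)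
        (λ eq → w≢0 (φ-kernel φ Φ φΦ Φφ w eq))
        (∘Φ-join E E' (φ ⟨$⟩ w) (subst (Join E E') (sym (Φφ w)) w∈join)))
      where
      finish : ∀ E' E'∈ w → (Σ I λ k → el k ⊆ Join (el (E , E∈)) (el (E' , E'∈)) × el k (φ ⟨$⟩ w)) →
        Σ Pred λ G → 𝒮 G × G ⊆ Join E E' × G w
      finish E' E'∈ w ((G , G∈) , G⊆ , Gw) =
        G , G∈ , ∘Φ-⊆ {G} {Join E E'} (λ w' Gw' → join-∘Φ E E' w' (G⊆ w' Gw')) , subst G (Φφ w) Gw

    ∋₁ : ∀ x → E₁ (Φ ⟨$⟩ (0v , x , 0v))
    ∋₁ x = subst E₁ (sym (Φ-0y0 x)) (g₁∈E₁ x)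
    ∋₂ : ∀ x → E₂ (Φ ⟨$⟩ (x , 0v , 0v))
    ∋₂ x = subst E₂ (sym (Φ-x00 x)) (Parametrization.sound (P ∈₂) x)
    ∋₃ : ∀ x → E₃ (Φ ⟨$⟩ (x , x , 0v))
    ∋₃ x = subst E₃ (sym (Φ-xy0 x x)) (L₂+g₁∈E₃ x)
    ∋₄ : ∀ x → E₄ (Φ ⟨$⟩ (0v , 0v , x))
    ∋₄ x = subst E₄ (sym (Φ-00z x)) (g₄∈E₄ x)
    ∋₅ : ∀ x → E₅ (Φ ⟨$⟩ (x , 0v , x))
    ∋₅ x = subst E₅ (sym (Φ-x0z x x)) (L₂+g₄∈E₅ x)

  open Framed (E₁ , ∈₁) (E₂ , ∈₂) (E₃ , ∈₃) (E₄ , ∈₄) (E₅ , ∈₅) ∋₁ ∋₂ ∋₃ ∋₄ ∋₅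
    (normal⇒ normal₁) (normal⇒ normal₂) (normal⇒ normal₃)
    using (𝐌; 𝐌₀; 𝐌₀-spread; 𝐌-semifield; element-T₃; T₃-element; normal-target; target-normal)

  abstract
    spread-onto : MapsOnto (φ ⟨$⟩_) 𝒮 (T₃ 𝐌 𝐌₀)
    spread-onto =
      (λ E E∈ → el (E , E∈) , element-T₃ (E , E∈) ,
        imageEq φ Φ φΦ Φφ E (el (E , E∈)) ((λ _ p → p) , (λ _ p → p))) ,
      (λ T T∈ → case T₃-element T T∈ of λ
        { ((E , E∈) , E≐T) → E , E∈ , imageEq φ Φ φΦ Φφ E T E≐T })

    normal-onto : MapsOnto (φ ⟨$⟩_) (NormalIn 𝒮 Π₀) (NormalTarget 𝐌 𝐌₀)
    normal-onto = there , back
      where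
      there : ∀ E → NormalIn 𝒮 Π₀ E → Σ Pred λ T → NormalTarget 𝐌 𝐌₀ T × ImageEq (φ ⟨$⟩_) E T
      there E (normal , E⊆Π₀) = el i ,
        normal-target i (normal⇒ normal) (λ w Ew → proj₁ Π₀∘Φ≐Π∞ w (E⊆Π₀ _ Ew)) ,
        imageEq φ Φ φΦ Φφ E (el i) ((λ _ p → p) , (λ _ p → p))
        where
        i : I
        i = E , proj₁ normal
      back : ∀ T → NormalTarget 𝐌 𝐌₀ T → Σ Pred λ E → NormalIn 𝒮 Π₀ E × ImageEq (φ ⟨$⟩_) E T
      back T T∈ = case target-normal T T∈ of λ
        { ((E , E∈) , normal , E⊆Π∞ , E≐T) → E ,
            (⇒normal (E , E∈) normal , ∘Φ-⊆ {E} {Π₀} (λ w Ew → proj₂ Π₀∘Φ≐Π∞ w (E⊆Π∞ w Ew))) ,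
            imageEq φ Φ φΦ Φφ E T E≐T }

  coordinatisation :
    Σ (List Mat) λ 𝐌₀ → Σ (List Mat) λ 𝐌 → Σ (W → W) λ φ →
    IsSpreadSet₀I 𝐌₀ × IsSemifieldSpreadSet 𝐌 × IsCollineation φ ×
    ImageEq φ Π₀ Π∞ × MapsOnto φ 𝒮 (T₃ 𝐌 𝐌₀) ×
    MapsOnto φ (NormalIn 𝒮 Π₀) (NormalTarget 𝐌 𝐌₀)
  coordinatisation = 𝐌₀ , 𝐌 , (φ ⟨$⟩_) , 𝐌₀-spread , 𝐌-semifield ,
    linear-collineation φ Φ φΦ Φφ , imageEq φ Φ φΦ Φφ Π₀ Π∞ Π₀∘Φ≐Π∞ , spread-onto , normal-onto

theorem5p9 : (q : ℕ) → OddPrimePower q → (𝔽 : FiniteField q) → (n : ℕ) →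
    let open Geometry 𝔽 n in
    (𝒮 : Family) → IsSpread 𝒮 →
    (Π₀ : Pred) → IsSubspace (n Data.Nat.+ n) Π₀ →
    (E₁ E₂ E₃ : Pred) →
    IsNormal 𝒮 E₁ → IsNormal 𝒮 E₂ → IsNormal 𝒮 E₃ →
    ¬ (E₁ ≐ E₂) → ¬ (E₁ ≐ E₃) → ¬ (E₂ ≐ E₃) →
    E₁ ⊆ Π₀ → E₂ ⊆ Π₀ → E₃ ⊆ Π₀ →
    Σ (List Mat) λ 𝐌₀ → Σ (List Mat) λ 𝐌 → Σ (W → W) λ φ →
    IsSpreadSet₀I 𝐌₀ × IsSemifieldSpreadSet 𝐌 × IsCollineation φ ×
    ImageEq φ Π₀ Π∞ × MapsOnto φ 𝒮 (T₃ 𝐌 𝐌₀) ×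
    MapsOnto φ (NormalIn 𝒮 Π₀) (NormalTarget 𝐌 𝐌₀)
-- For n = 0 the space consists of the zero vector alone, so any two elements coincide, against
-- distinctness of `E₁` and `E₂`.
theorem5p9 q _ 𝔽 zero 𝒮 (subspaces , _) _ _ E₁ E₂ _ (∈₁ , _) (∈₂ , _) _ E₁≢E₂ =
  contradiction (within E₁ E₂ ∈₂ , within E₂ E₁ ∈₁) E₁≢E₂
  where
  open Geometry 𝔽 0
  within : ∀ E E' → 𝒮 E' → E ⊆ E'
  within E E' E'∈ ([] , [] , []) _ with subspaces E' E'∈
  ... | [] , _ , spans = proj₂ (spans _) ([] , refl)
theorem5p9 q _ 𝔽 (suc m) 𝒮 spread Π₀ Π₀-subspace E₁ E₂ E₃ =
  λ normal₁ normal₂ normal₃ E₁≢E₂ E₁≢E₃ E₂≢E₃ E₁⊆Π₀ E₂⊆Π₀ E₃⊆Π₀ →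
  -- The reference vector `e` is the first unit vector, nonzero because 0 ≠ 1 in the field.
  Frame.coordinatisation 𝔽 (suc m) (1# ∷ replicate m 0#) (λ eq → 0≢1 (sym (cong Vec.head eq)))
    𝒮 spread Π₀ Π₀-subspace E₁ E₂ E₃ normal₁ normal₂ normal₃ E₁≢E₂ E₁≢E₃ E₂≢E₃ E₁⊆Π₀ E₂⊆Π₀ E₃⊆Π₀
  where open FiniteField 𝔽
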